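{- Let $q$ be a prime power, $n\ge1$, and $1\le k\le n$. Let $U\subseteq H_n(\mathbb{F}_{q^2})$ be a linear constant rank-distance $k$ set. Then \[ |U|\le \begin{cases} q^k & \text{if $k$ is odd},\\ q^{2n-k} & \text{if $k$ is even}.\end{cases} \]
   Context: $H_n(\mathbb{F}_{q^2})$ is the set of $n\times n$ matrices $A$ over $\mathbb{F}_{q^2}$ with $\overline{A}^T=A$, where $\overline{\cdot}$ applies $x\mapsto x^q$ entrywise; it is an $\mathbb{F}_q$-vector space. A constant rank-distance $k$ set is a set $U$ of $n\times n$ matrices such that $\mathrm{rank}(A-B)=k$ for all distinct $A,B\in U$ and $\mathrm{rank}(A)=k$ for all nonzero $A\in U$. It is called linear if it is closed under $F'$-linear combinations for some field $F'$ (here a subfield of $\mathbb{F}_q$); in particular it is closed under addition. -}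

module Defs where

open import Level using (0ℓ)
open import Data.Nat as ℕ using (ℕ; zero; suc)
open import Data.Nat.Primality using (Prime)
open import Data.Fin using (Fin)
open import Data.Vec using (Vec; lookup; tabulate; replicate; zipWith; map)
open import Data.List using (List; length)
open import Data.List.Membership.Propositional using (_∈_)
open import Data.List.Relation.Unary.Unique.Propositional using (Unique)
open import Data.Product using (Σ; ∃; _×_)
open import Relation.Nullary using (¬_)
open import Relation.Binary.PropositionalEquality using (_≡_; _≢_)
open import Algebra.Structures using (IsCommutativeRing)

IsPrimePower : ℕ → Set
IsPrimePower q = Σ ℕ λ p → Σ ℕ λ e → Prime p × 1 ℕ.≤ e × q ≡ p ℕ.^ e

record FiniteField (card : ℕ) : Set₁ where
  infixl 6 _+_
  infixl 7 _*_
  field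
    Carrier : Set
    _+_ _*_ : Carrier → Carrier → Carrier
    -_      : Carrier → Carrier
    0# 1#   : Carrier
    isCommutativeRing : IsCommutativeRing _≡_ _+_ _*_ -_ 0# 1#
    1≢0     : 1# ≢ 0#
    inverse : ∀ x → x ≢ 0# → Σ Carrier λ y → x * y ≡ 1#
    elements : List Carrier
    elements-unique   : Unique elements
    elements-complete : ∀ x → x ∈ elements
    elements-card     : length elements ≡ card

  _^_ : Carrier → ℕ → Carrier
  x ^ zero  = 1#
  x ^ suc m = x * (x ^ m)

module Hermitian (q : ℕ) (F : FiniteField (q ℕ.* q)) where
  open FiniteField F

  conj : Carrier → Carrier
  conj x = x ^ q

  Mat : ℕ → Set
  Mat n = Vec (Vec Carrier n) n

  entry : ∀ {n} → Mat n → Fin n → Fin n → Carrier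
  entry A i j = lookup (lookup A i) j

  IsHermitian : ∀ {n} → Mat n → Set
  IsHermitian {n} A = ∀ (i j : Fin n) → entry A j i ≡ conj (entry A i j)

  _⊕_ : ∀ {n} → Mat n → Mat n → Mat n
  A ⊕ B = zipWith (zipWith _+_) A B

  _⊛_ : ∀ {n} → Carrier → Mat n → Mat n
  a ⊛ A = map (map (a *_)) A

  _⊝_ : ∀ {n} → Mat n → Mat n → Mat n
  A ⊝ B = A ⊕ ((- 1#) ⊛ B)

  zeroMat : ∀ {n} → Mat n
  zeroMat {n} = replicate n (replicate n 0#)

  column : ∀ {n} → Mat n → Fin n → Vec Carrier n
  column A j = map (λ row → lookup row j) A

  lincomb : ∀ {n} r → (Fin r → Carrier) → (Fin r → Vec Carrier n) → Vec Carrier n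
  lincomb {n} zero    c v = replicate n 0#
  lincomb {n} (suc r) c v =
    zipWith _+_ (map (c Fin.zero *_) (v Fin.zero))
                (lincomb r (λ i → c (Fin.suc i)) (λ i → v (Fin.suc i)))
    where import Data.Fin as Fin

  LinIndep : ∀ {n} r → (Fin r → Vec Carrier n) → Set
  LinIndep {n} r v = ∀ (c : Fin r → Carrier) → lincomb r c v ≡ replicate n 0# → ∀ i → c i ≡ 0#

  HasRank : ∀ {n} → Mat n → ℕ → Set
  HasRank {n} A r =
    (Σ (Fin r → Fin n) λ f → LinIndep r (λ i → column A (f i))) ×
    (∀ (f : Fin (suc r) → Fin n) → ¬ LinIndep (suc r) (λ i → column A (f i)))

  record IsSubfieldOfFq (S : Carrier → Set) : Set where
    field
      has-0 : S 0#
      has-1 : S 1#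
      +-closed : ∀ {x y} → S x → S y → S (x + y)
      neg-closed : ∀ {x} → S x → S (- x)
      *-closed : ∀ {x y} → S x → S y → S (x * y)
      inv-closed : ∀ {x y} → S x → x * y ≡ 1# → S y
      in-Fq : ∀ {x} → S x → x ^ q ≡ x

  -- U (a finite set of matrices, listed without repetition) is a
  -- constant rank-distance k set
  ConstantRankDistance : ∀ {n} → ℕ → List (Mat n) → Set
  ConstantRankDistance k U =
    (∀ {A B} → A ∈ U → B ∈ U → A ≢ B → HasRank (A ⊝ B) k) ×
    (∀ {A} → A ∈ U → A ≢ zeroMat → HasRank A k)

  IsLinear : ∀ {n} → List (Mat n) → Set₁
  IsLinear U = Σ (Carrier → Set) λ S → IsSubfieldOfFq S ×
    (∀ {A B a b} → A ∈ U → B ∈ U → S a → S b → ((a ⊛ A) ⊕ (b ⊛ B)) ∈ U)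

{-# OPTIONS --safe #-}
module Submission where

-- Let N = |U| and, for A in U, let Z(A) be the number of vectors v with v* A v = 0.  Splitting off a
-- nonisotropic vector v replaces the space by v^⊥ and multiplies q Z - q^(2 dim) by -q, because the norm
-- c ↦ c^(q+1) takes every nonzero value of F_q exactly q + 1 times; on the radical, reached after k steps for
-- a matrix of rank k, this difference is (q - 1) q^(2(n-k)).  Hence a hermitian matrix of rank k has
-- q Z(A) = q^(2n) + (-1)^k (q - 1) q^(2n-k).
-- On the other hand, for each v the additive map A ↦ v* A v from U to F_q has a kernel U_v with N ∣ q |U_v|.
-- Summing q Z(A) = q #{v | A ∈ U_v} over A in U gives
--   q^(2n+1) + (N - 1) (q^(2n) + (-1)^k (q - 1) q^(2n-k)) = Σ_v q |U_v|.
-- For odd k, the right-hand side exceeds q^(2n) N, so that N ≤ q^k.  For even k, it is divisible by N, so that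
-- N ∣ (q - 1) (q^k - 1) q^(2n-k); as U is a subgroup, N divides a power of q, and therefore N ∣ q^(2n-k).

open import Level using (0ℓ)
open import Algebra.Bundles using (CommutativeRing)
open import Algebra.Structures using (IsAbelianGroup)
open import Data.Fin as Fin using (Fin)
import Data.Fin.Properties as Finₚ
open import Data.List as List using (List; []; _∷_; _++_; length; filter; foldr; deduplicate; cartesianProduct)
import Data.List.Properties as Listₚ
open import Data.List.Membership.Propositional using (_∈_; lose; find)
open import Data.List.Membership.Propositional.Properties using (∈-map⁺; ∈-map⁻; ∈-filter⁺; ∈-filter⁻; ∈-deduplicate⁺; ∈-deduplicate⁻; ∈-cartesianProduct⁺; ∈-cartesianProduct⁻; ∈-length)
open import Data.List.Membership.Propositional.Properties.WithK using (unique∧set⇒bag)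
import Data.List.Membership.DecPropositional as DecMembership
open import Data.List.Relation.Binary.BagAndSetEquality using (∼bag⇒↭)
open import Data.List.Relation.Binary.Permutation.Propositional using (_↭_; ↭⇒↭ₛ)
import Data.List.Relation.Binary.Permutation.Propositional.Properties as ↭ₚ
import Data.List.Relation.Binary.Permutation.Setoid.Properties as ↭ₛ
open import Data.List.Relation.Unary.All as All using ()
open import Data.List.Relation.Unary.AllPairs as AllPairs using ()
open import Data.List.Relation.Unary.Any as Any using (here; there)
import Data.List.Relation.Unary.Any.Properties as Anyₚ
open import Data.List.Relation.Unary.Unique.Propositional using (Unique)
import Data.List.Relation.Unary.Unique.Propositional.Properties as Uniqueₚ
import Data.List.Relation.Unary.Unique.DecPropositional.Properties as DecUniqueₚ
open import Data.Maybe using (nothing)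
open import Data.Nat as ℕ using (ℕ; zero; suc; pred; _≤_; _<_; z≤n; s≤s; _%_)
import Data.Nat.Properties as ℕₚ
open import Algebra.Properties.CommutativeSemigroup ℕₚ.+-commutativeSemigroup using (interchange)
open import Data.Nat.Combinatorics using (_C_; nCk≡n!/k![n-k]!; k![n∸k]!∣n!; nCn≡1)
open import Data.Nat.Coprimality using (Coprime; coprime-divisor)
open import Data.Nat.Divisibility as Div using (_∣_; divides; ∣-trans)
open import Data.Nat.DivMod using (m/n*n≡m)
import Data.Nat.ListAction as ListAction
import Data.Nat.ListAction.Properties as ListActionₚ
open import Data.Nat.Primality using (Prime; euclidsLemma; prime⇒nonZero; prime⇒nonTrivial)
open import Data.Product using (Σ; ∃; _×_; _,_; proj₁; proj₂; uncurry)
open import Data.Sum using (inj₁; inj₂)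
open import Data.Vec as Vec using (Vec; []; _∷_; replicate; lookup; zipWith; tabulate)
import Data.Vec.Functional as Vector
import Data.Vec.Properties as Vecₚ
open import Function using (_∘_; id; mk⇔)
open import Relation.Binary using (tri<; tri≈; tri>)
open import Relation.Binary.Definitions using (DecidableEquality)
open import Relation.Binary.PropositionalEquality using (_≡_; _≢_; refl; sym; trans; cong; cong₂; subst; subst₂; setoid; isEquivalence; module ≡-Reasoning)
open import Relation.Nullary using (¬_; ¬?; Dec; yes; no; contradiction)
open import Relation.Nullary.Decidable using (map′; decidable-stable)
open import Relation.Unary using (Decidable)
open import Tactic.RingSolver.Core.AlmostCommutativeRing using (fromCommutativeRing)
import Tactic.RingSolver.NonReflective as Solver
open import Defs

-- Counting in finite lists

-- The two parities call for different arguments because the sign of the defect changes. For even k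
-- every nonzero matrix has q Z(A) > q^(2n), so the lower bound N on each q |U_v| holds anyway and
-- only divisibility carries information. For odd k the defect is negative and the lower bound
-- bites; its strictness turns N < q^k + 1 into N ≤ q^k. Dimensions and diagonal forms are avoided:
-- a subspace is a duplicate-free list, v^⊥ has 1/q^2 of its elements, and the number of splitting
-- steps is identified with the rank only afterwards, by comparing q^(2n) with the size of the
-- nullspace. The sign (-1)^k is split by parity, so that every identity lives in the natural
-- numbers. The facts on F_q are obtained by counting roots. For the norm, the bounds q - 1 on its
-- nonzero values and q + 1 on its kernel have product q^2 - 1, so both are attained. Since x + x^q
-- has at most q roots, the trace is nonzero somewhere; this replaces the division by 2 in
-- polarization and covers characteristic 2.

private variable
  A B : Set

infix 6 [_]
[_] : {P : Set} → Dec P → ℕ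
[ yes _ ] = 1
[ no _ ]  = 0

∑ : List A → (A → ℕ) → ℕ
∑ xs f = ListAction.sum (List.map f xs)

infix 4 _≅_
_≅_ : List A → List A → Set
xs ≅ ys = (∀ {z} → z ∈ xs → z ∈ ys) × (∀ {z} → z ∈ ys → z ∈ xs)

∑-cong : (xs : List A) {f g : A → ℕ} → (∀ {x} → x ∈ xs → f x ≡ g x) → ∑ xs f ≡ ∑ xs g
∑-cong []       f≡g = refl
∑-cong (x ∷ xs) f≡g = cong₂ ℕ._+_ (f≡g (here refl)) (∑-cong xs (f≡g ∘ there))

∑-mono : (xs : List A) {f g : A → ℕ} → (∀ {x} → x ∈ xs → f x ≤ g x) → ∑ xs f ≤ ∑ xs g
∑-mono []       f≤g = z≤n
∑-mono (x ∷ xs) f≤g = ℕₚ.+-mono-≤ (f≤g (here refl)) (∑-mono xs (f≤g ∘ there))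

∑-∣ : (xs : List A) {f : A → ℕ} {d : ℕ} → (∀ {x} → x ∈ xs → d ∣ f x) → d ∣ ∑ xs f
∑-∣ []       d∣f = _ Div.∣0
∑-∣ (x ∷ xs) d∣f = Div.∣m∣n⇒∣m+n (d∣f (here refl)) (∑-∣ xs (d∣f ∘ there))

∑-+ : (xs : List A) (f g : A → ℕ) → ∑ xs (λ x → f x ℕ.+ g x) ≡ ∑ xs f ℕ.+ ∑ xs g
∑-+ []       f g = refl
∑-+ (x ∷ xs) f g = trans (cong (f x ℕ.+ g x ℕ.+_) (∑-+ xs f g)) (interchange (f x) (g x) (∑ xs f) (∑ xs g))

∑-* : (xs : List A) (c : ℕ) (f : A → ℕ) → ∑ xs (λ x → c ℕ.* f x) ≡ c ℕ.* ∑ xs f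
∑-* []       c f = sym (ℕₚ.*-zeroʳ c)
∑-* (x ∷ xs) c f = trans (cong (c ℕ.* f x ℕ.+_) (∑-* xs c f)) (sym (ℕₚ.*-distribˡ-+ c (f x) (∑ xs f)))

∑-const : (xs : List A) (c : ℕ) → ∑ xs (λ _ → c) ≡ length xs ℕ.* c
∑-const []       c = refl
∑-const (x ∷ xs) c = cong (c ℕ.+_) (∑-const xs c)

∑-zero : (xs : List A) → ∑ xs (λ _ → 0) ≡ 0
∑-zero xs = trans (∑-const xs 0) (ℕₚ.*-zeroʳ (length xs))

∑-swap : (xs : List A) (ys : List B) (f : A → B → ℕ) →
         ∑ xs (λ x → ∑ ys (f x)) ≡ ∑ ys (λ y → ∑ xs (λ x → f x y))
∑-swap []       ys f = sym (∑-zero ys)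
∑-swap (x ∷ xs) ys f = trans (cong (∑ ys (f x) ℕ.+_) (∑-swap xs ys f))
                             (sym (∑-+ ys (f x) (λ y → ∑ xs (λ x → f x y))))

∑-map : (g : A → B) (xs : List A) (f : B → ℕ) → ∑ (List.map g xs) f ≡ ∑ xs (f ∘ g)
∑-map g xs f = cong ListAction.sum (sym (Listₚ.map-∘ xs))

∑-cartesianProduct : (xs : List A) (ys : List B) (f : A × B → ℕ) →
  ∑ (cartesianProduct xs ys) f ≡ ∑ xs (λ x → ∑ ys (λ y → f (x , y)))
∑-cartesianProduct []       ys f = refl
∑-cartesianProduct (x ∷ xs) ys f = begin
  ListAction.sum (List.map f (List.map (x ,_) ys ++ cartesianProduct xs ys))
    ≡⟨ cong ListAction.sum (Listₚ.map-++ f (List.map (x ,_) ys) (cartesianProduct xs ys)) ⟩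
  ListAction.sum (List.map f (List.map (x ,_) ys) ++ List.map f (cartesianProduct xs ys))
    ≡⟨ ListActionₚ.sum-++ (List.map f (List.map (x ,_) ys)) _ ⟩
  ∑ (List.map (x ,_) ys) f ℕ.+ ∑ (cartesianProduct xs ys) f
    ≡⟨ cong₂ ℕ._+_ (∑-map (x ,_) ys f) (∑-cartesianProduct xs ys f) ⟩
  ∑ ys (λ y → f (x , y)) ℕ.+ ∑ xs (λ x → ∑ ys (λ y → f (x , y))) ∎
  where open ≡-Reasoning

length-filter-∑ : {P : A → Set} (P? : Decidable P) (xs : List A) →
                  length (filter P? xs) ≡ ∑ xs (λ x → [ P? x ])
length-filter-∑ P? []       = refl
length-filter-∑ P? (x ∷ xs) with P? x
... | yes _ = cong suc (length-filter-∑ P? xs)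
... | no  _ = length-filter-∑ P? xs

-- Membership proofs in a duplicate-free list are unique, so equality as sets is already equality as
-- bags.
≅⇒↭ : {xs ys : List A} → Unique xs → Unique ys → xs ≅ ys → xs ↭ ys
≅⇒↭ xs! ys! (to , from) = ∼bag⇒↭ (unique∧set⇒bag xs! ys! (mk⇔ to from))

≅-length : {xs ys : List A} → Unique xs → Unique ys → xs ≅ ys → length xs ≡ length ys
≅-length xs! ys! eq = ↭ₚ.↭-length (≅⇒↭ xs! ys! eq)

≅-∑ : {xs ys : List A} (f : A → ℕ) → Unique xs → Unique ys → xs ≅ ys → ∑ xs f ≡ ∑ ys f
≅-∑ f xs! ys! eq = ListActionₚ.sum-↭ (↭ₚ.map⁺ f (≅⇒↭ xs! ys! eq))

map-unique : (g : A → B) {xs : List A} → (∀ {x y} → x ∈ xs → y ∈ xs → g x ≡ g y → x ≡ y) →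
             Unique xs → Unique (List.map g xs)
map-unique g {[]}     inj _ = AllPairs.[]
map-unique g {x ∷ xs} inj (x∉ AllPairs.∷ xs!) =
  All.tabulate fresh AllPairs.∷ map-unique g (λ p q → inj (there p) (there q)) xs!
  where
  fresh : ∀ {y} → y ∈ List.map g xs → g x ≢ y
  fresh y∈ gx≡y with ∈-map⁻ g y∈
  ... | z , z∈ , y≡gz = All.lookup x∉ z∈ (inj (here refl) (there z∈) (trans gx≡y y≡gz))

module Finite (_≟_ : DecidableEquality A) where

  open DecMembership _≟_ using (_∈?_)

  ⊆-length : {xs ys : List A} → Unique xs → Unique ys → (∀ {z} → z ∈ xs → z ∈ ys) → length xs ≤ length ys
  ⊆-length {xs} {ys} xs! ys! xs⊆ys = begin
    length xs                   ≡⟨ ≅-length xs! (Uniqueₚ.filter⁺ (_∈? xs) ys!)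
                                     ((λ z∈ → ∈-filter⁺ (_∈? xs) (xs⊆ys z∈) z∈) , proj₂ ∘ ∈-filter⁻ (_∈? xs) {xs = ys}) ⟩
    length (filter (_∈? xs) ys) ≤⟨ Listₚ.length-filter (_∈? xs) ys ⟩
    length ys                   ∎
    where open ℕₚ.≤-Reasoning

  -- A missing element put in front of `xs` would give a duplicate-free sublist of `ys` that is too
  -- long.
  ⊆-reverse : {xs ys : List A} → Unique xs → Unique ys → (∀ {z} → z ∈ xs → z ∈ ys) →
              length ys ≤ length xs → ∀ {z} → z ∈ ys → z ∈ xs
  ⊆-reverse {xs} {ys} xs! ys! xs⊆ys ys≤xs {z} z∈ys with z ∈? xs
  ... | yes z∈xs = z∈xs
  ... | no  z∉xs = contradiction (ℕₚ.≤-trans more ys≤xs) (ℕₚ.<-irrefl refl)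
    where
    more : length (z ∷ xs) ≤ length ys
    more = ⊆-length (All.tabulate (λ { x∈ refl → z∉xs x∈ }) AllPairs.∷ xs!) ys!
             λ { (here refl) → z∈ys ; (there x∈) → xs⊆ys x∈ }

  count-one : {xs : List A} → Unique xs → ∀ {x} → x ∈ xs → ∑ xs (λ y → [ x ≟ y ]) ≡ 1
  count-one {xs} xs! {x} x∈ = trans (sym (length-filter-∑ (x ≟_) xs))
    (≅-length (Uniqueₚ.filter⁺ (x ≟_) xs!) (All.[] AllPairs.∷ AllPairs.[])
      ((λ z∈ → here (sym (proj₂ (∈-filter⁻ (x ≟_) {xs = xs} z∈)))) ,
       λ { (here refl) → ∈-filter⁺ (x ≟_) x∈ refl }))

module Fibres (_≟_ : DecidableEquality B) (φ : A → B) where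

  open Finite _≟_

  fibre : List A → B → List A
  fibre xs y = filter (λ x → φ x ≟ y) xs

  -- Each `x` is counted once as the sum of the indicators of `φ x ≟ y`; then the two sums are
  -- exchanged.
  length-fibres : ∀ {xs ys} → Unique ys → (∀ {x} → x ∈ xs → φ x ∈ ys) →
                  length xs ≡ ∑ ys (length ∘ fibre xs)
  length-fibres {xs} {ys} ys! into = begin
    length xs                                 ≡⟨ ℕₚ.*-identityʳ (length xs) ⟨
    length xs ℕ.* 1                             ≡⟨ ∑-const xs 1 ⟨
    ∑ xs (λ _ → 1)                            ≡⟨ ∑-cong xs (λ x∈ → count-one ys! (into x∈)) ⟨
    ∑ xs (λ x → ∑ ys (λ y → [ φ x ≟ y ]))     ≡⟨ ∑-swap xs ys _ ⟩
    ∑ ys (λ y → ∑ xs (λ x → [ φ x ≟ y ]))     ≡⟨ ∑-cong ys (λ {y} _ → length-filter-∑ (λ x → φ x ≟ y) xs) ⟨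
    ∑ ys (length ∘ fibre xs)                  ∎
    where open ≡-Reasoning

  image : List A → List B
  image xs = deduplicate _≟_ (List.map φ xs)

  image-unique : ∀ xs → Unique (image xs)
  image-unique xs = DecUniqueₚ.deduplicate-! _≟_ (List.map φ xs)

  ∈-image⁺ : ∀ {xs x} → x ∈ xs → φ x ∈ image xs
  ∈-image⁺ x∈ = ∈-deduplicate⁺ _≟_ (∈-map⁺ φ x∈)

  ∈-image⁻ : ∀ xs {y} → y ∈ image xs → ∃ λ x → x ∈ xs × y ≡ φ x
  ∈-image⁻ xs y∈ = ∈-map⁻ φ (∈-deduplicate⁻ _≟_ (List.map φ xs) y∈)

  uniform-fibres : ∀ {xs c} → (∀ {x} → x ∈ xs → length (fibre xs (φ x)) ≡ c) →
                   length xs ≡ length (image xs) ℕ.* c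
  uniform-fibres {xs} {c} size = begin
    length xs                       ≡⟨ length-fibres (image-unique xs) ∈-image⁺ ⟩
    ∑ (image xs) (length ∘ fibre xs) ≡⟨ ∑-cong (image xs) (λ y∈ → size′ (∈-image⁻ xs y∈)) ⟩
    ∑ (image xs) (λ _ → c)          ≡⟨ ∑-const (image xs) c ⟩
    length (image xs) ℕ.* c           ∎
    where
    open ≡-Reasoning
    size′ : ∀ {y} → (∃ λ x → x ∈ xs × y ≡ φ x) → length (fibre xs y) ≡ c
    size′ (x , x∈ , refl) = size x∈

-- Finite subgroups of abelian groups: Lagrange's theorem, images and kernels

module Subgroups {G : Set} {_∙_ : G → G → G} {ε : G} {_⁻¹ : G → G}
                 (isAbelianGroup : IsAbelianGroup _≡_ _∙_ ε _⁻¹) where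

  open IsAbelianGroup isAbelianGroup using (assoc; identityˡ; inverseˡ; inverseʳ)

  record IsSubgroup (H : List G) : Set where
    field
      unique   : Unique H
      ε-closed : ε ∈ H
      ∙-closed : ∀ {x y} → x ∈ H → y ∈ H → x ∙ y ∈ H
      ⁻¹-closed : ∀ {x} → x ∈ H → (x ⁻¹) ∈ H

  ∙-cancel : ∀ x y → (x ⁻¹) ∙ (x ∙ y) ≡ y
  ∙-cancel x y = trans (sym (assoc (x ⁻¹) x y)) (trans (cong (_∙ y) (inverseˡ x)) (identityˡ y))

  ∙-cancel′ : ∀ x y → x ∙ ((x ⁻¹) ∙ y) ≡ y
  ∙-cancel′ x y = trans (sym (assoc x (x ⁻¹) y)) (trans (cong (_∙ y) (inverseʳ x)) (identityˡ y))

  ∙-injective : ∀ x {y z} → x ∙ y ≡ x ∙ z → y ≡ z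
  ∙-injective x {y} {z} eq = trans (sym (∙-cancel x y)) (trans (cong ((x ⁻¹) ∙_) eq) (∙-cancel x z))

  -- The last two hypotheses say that `ys` lists the coset of `x`, in a form that suits both the
  -- cosets in Lagrange's theorem and the fibres of a homomorphism.
  coset-length : ∀ {ys} x {H} → Unique H → Unique ys →
                 (∀ {h} → h ∈ H → x ∙ h ∈ ys) → (∀ {y} → y ∈ ys → (x ⁻¹) ∙ y ∈ H) → length ys ≡ length H
  coset-length {ys} x {H} H! ys! to from =
    trans (≅-length ys! (Uniqueₚ.map⁺ (∙-injective x) H!)
             ((λ {z} z∈ → subst (_∈ List.map (x ∙_) H) (∙-cancel′ x z) (∈-map⁺ (x ∙_) (from z∈))) ,
              (λ z∈ → unmap (∈-map⁻ (x ∙_) z∈))))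
          (Listₚ.length-map (x ∙_) H)
    where
    unmap : ∀ {z} → (∃ λ h → h ∈ H × z ≡ x ∙ h) → z ∈ ys
    unmap (h , h∈ , refl) = to h∈

  module _ (_≟_ : DecidableEquality G) where

    open DecMembership _≟_ using (_∈?_)

    -- All cosets are filtered from the same list `K`, so equal cosets are equal as lists. The
    -- cosets are thus the values of a map with decidable equality whose fibres all have the size of
    -- `H`; neither a quotient nor representatives have to be chosen.
    lagrange : ∀ {H K} → IsSubgroup H → IsSubgroup K → (∀ {x} → x ∈ H → x ∈ K) → length H ∣ length K
    lagrange {H} {K} H≤ K≤ H⊆K = divides (length (image K)) (uniform-fibres size)
      where
      module H = IsSubgroup H≤
      module K = IsSubgroup K≤

      coset : G → List G
      coset x = filter (λ y → ((x ⁻¹) ∙ y) ∈? H) K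

      open Fibres (Listₚ.≡-dec _≟_) coset

      sub : ∀ x y z → ((x ⁻¹) ∙ y) ∙ ((y ⁻¹) ∙ z) ≡ (x ⁻¹) ∙ z
      sub x y z = trans (assoc (x ⁻¹) y _) (cong ((x ⁻¹) ∙_) (∙-cancel′ y z))

      flip : ∀ x y → ((x ⁻¹) ∙ y) ⁻¹ ≡ (y ⁻¹) ∙ x
      flip x y = ∙-injective ((x ⁻¹) ∙ y) (trans (inverseʳ _) (trans (sym (inverseˡ x)) (sym (sub x y x))))

      coset-cong : ∀ {x y} → (x ⁻¹) ∙ y ∈ H → coset x ≡ coset y
      coset-cong {x} {y} d∈ = Listₚ.filter-≐ _ _
        ((λ {z} p → subst (_∈ H) (sub y x z) (H.∙-closed (subst (_∈ H) (flip x y) (H.⁻¹-closed d∈)) p)) ,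
         (λ {z} p → subst (_∈ H) (sub x y z) (H.∙-closed d∈ p))) K

      size : ∀ {x} → x ∈ K → length (fibre K (coset x)) ≡ length H
      size {x} x∈ = coset-length x H.unique (Uniqueₚ.filter⁺ _ K.unique) to from
        where
        to : ∀ {h} → h ∈ H → x ∙ h ∈ fibre K (coset x)
        to {h} h∈ = ∈-filter⁺ _ (K.∙-closed x∈ (H⊆K h∈))
                      (sym (coset-cong (subst (_∈ H) (sym (∙-cancel x h)) h∈)))
        from : ∀ {y} → y ∈ fibre K (coset x) → (x ⁻¹) ∙ y ∈ H
        from {y} y∈ with ∈-filter⁻ (λ z → Listₚ.≡-dec _≟_ (coset z) (coset x)) {xs = K} y∈
        -- `y` lies in its own coset, which is the same list as the coset of `x`.
        ... | y∈K , eq = proj₂ (∈-filter⁻ (λ z → ((x ⁻¹) ∙ z) ∈? H) {xs = K}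
                 (subst (y ∈_) eq (∈-filter⁺ (λ z → ((y ⁻¹) ∙ z) ∈? H) y∈K (subst (_∈ H) (sym (inverseˡ y)) H.ε-closed))))

module Homomorphisms {G : Set} {_∙_ : G → G → G} {ε : G} {_⁻¹ : G → G}
                     (G-isAbelianGroup : IsAbelianGroup _≡_ _∙_ ε _⁻¹)
                     {G′ : Set} {_∘′_ : G′ → G′ → G′} {ε′ : G′} {_⁻¹′ : G′ → G′}
                     (G′-isAbelianGroup : IsAbelianGroup _≡_ _∘′_ ε′ _⁻¹′)
                     (_≟_ : DecidableEquality G′)
                     (φ : G → G′) (homo : ∀ x y → φ (x ∙ y) ≡ φ x ∘′ φ y) where

  module G = Subgroups G-isAbelianGroup
  module G′ = Subgroups G′-isAbelianGroup
  open IsAbelianGroup using (identityˡ; identityʳ; inverseˡ; inverseʳ)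
  open Fibres _≟_ φ public

  φ-ε : φ ε ≡ ε′
  φ-ε = G′.∙-injective (φ ε)
    (trans (sym (homo ε ε)) (trans (cong φ (identityˡ G-isAbelianGroup ε)) (sym (identityʳ G′-isAbelianGroup (φ ε)))))

  φ-⁻¹ : ∀ x → φ (x ⁻¹) ≡ φ x ⁻¹′
  φ-⁻¹ x = G′.∙-injective (φ x)
    (trans (sym (homo x (x ⁻¹))) (trans (cong φ (inverseʳ G-isAbelianGroup x)) (trans φ-ε (sym (inverseʳ G′-isAbelianGroup (φ x))))))

  kernel : List G → List G
  kernel H = fibre H ε′

  -- The fibre through `x` is the coset of the kernel by `x`.
  image-kernel : ∀ {H} → G.IsSubgroup H → length H ≡ length (image H) ℕ.* length (kernel H)
  image-kernel {H} H≤ = uniform-fibres size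
    where
    module H = G.IsSubgroup H≤
    size : ∀ {x} → x ∈ H → length (fibre H (φ x)) ≡ length (kernel H)
    size {x} x∈ = G.coset-length x (Uniqueₚ.filter⁺ _ H.unique) (Uniqueₚ.filter⁺ _ H.unique) to from
      where
      to : ∀ {h} → h ∈ kernel H → x ∙ h ∈ fibre H (φ x)
      to {h} h∈ with ∈-filter⁻ _ {xs = H} h∈
      ... | h∈H , φh = ∈-filter⁺ _ (H.∙-closed x∈ h∈H)
              (trans (homo x h) (trans (cong (φ x ∘′_) φh) (identityʳ G′-isAbelianGroup (φ x))))
      from : ∀ {y} → y ∈ fibre H (φ x) → (x ⁻¹) ∙ y ∈ kernel H
      from {y} y∈ with ∈-filter⁻ _ {xs = H} y∈
      ... | y∈H , φy = ∈-filter⁺ _ (H.∙-closed (H.⁻¹-closed x∈) y∈H)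
              (trans (homo (x ⁻¹) y) (trans (cong₂ _∘′_ (φ-⁻¹ x) φy) (inverseˡ G′-isAbelianGroup (φ x))))

  image-subgroup : ∀ {H} → G.IsSubgroup H → G′.IsSubgroup (image H)
  image-subgroup {H} H≤ = record
    { unique = image-unique H
    ; ε-closed = subst (_∈ image H) φ-ε (∈-image⁺ H.ε-closed)
    ; ∙-closed = λ y∈ z∈ → mul (∈-image⁻ H y∈) (∈-image⁻ H z∈)
    ; ⁻¹-closed = λ y∈ → inv (∈-image⁻ H y∈)
    }
    where
    module H = G.IsSubgroup H≤
    Im : G′ → Set
    Im y = ∃ λ x → x ∈ H × y ≡ φ x
    mul : ∀ {y z} → Im y → Im z → y ∘′ z ∈ image H
    mul (x , x∈ , refl) (x′ , x′∈ , refl) = subst (_∈ image H) (homo x x′) (∈-image⁺ (H.∙-closed x∈ x′∈))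
    inv : ∀ {y} → Im y → (y ⁻¹′) ∈ image H
    inv (x , x∈ , refl) = subst (_∈ image H) (φ-⁻¹ x) (∈-image⁺ (H.⁻¹-closed x∈))

-- Finite fields

prime∤! : ∀ {p} → Prime p → ∀ {n} → n < p → ¬ (p ∣ n ℕ.!)
prime∤! {p} pr {zero}  _   p∣ = contradiction (Div.∣⇒≤ p∣) (ℕₚ.<⇒≱ (ℕ.nonTrivial⇒n>1 p {{prime⇒nonTrivial pr}}))
prime∤! {p} pr {suc n} n<p p∣ with euclidsLemma (suc n) (n ℕ.!) pr p∣
... | inj₁ p∣n  = contradiction (Div.∣⇒≤ p∣n) (ℕₚ.<⇒≱ n<p)
... | inj₂ p∣n! = prime∤! pr (ℕₚ.<-trans (ℕₚ.n<1+n n) n<p) p∣n!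

-- `p` divides `p !`, which is the binomial coefficient times two factorials of numbers below `p`.
prime∣C : ∀ {p} → Prime p → ∀ {k} → 0 < k → k < p → p ∣ p C k
prime∣C {p@(suc _)} pr {k} 0<k k<p
  with euclidsLemma (p C k) (k ℕ.! ℕ.* (p ℕ.∸ k) ℕ.!) pr (subst (p ∣_) (sym eq) (Div.∣m⇒∣m*n _ Div.∣-refl))
  where
  instance nz : ℕ.NonZero (k ℕ.! ℕ.* (p ℕ.∸ k) ℕ.!)
  nz = k ℕₚ.!* (p ℕ.∸ k) !≢0
  eq : (p C k) ℕ.* (k ℕ.! ℕ.* (p ℕ.∸ k) ℕ.!) ≡ p ℕ.!
  eq = trans (cong (ℕ._* (k ℕ.! ℕ.* (p ℕ.∸ k) ℕ.!)) (nCk≡n!/k![n-k]! (ℕₚ.<⇒≤ k<p)))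
             (m/n*n≡m (k![n∸k]!∣n! (ℕₚ.<⇒≤ k<p)))
... | inj₁ p∣C = p∣C
... | inj₂ p∣! with euclidsLemma (k ℕ.!) ((p ℕ.∸ k) ℕ.!) pr p∣!
...   | inj₁ p∣k = contradiction p∣k (prime∤! pr k<p)
...   | inj₂ p∣ = contradiction p∣ (prime∤! pr (ℕₚ.∸-monoʳ-< 0<k (ℕₚ.<⇒≤ k<p)))

module FieldProperties {card : ℕ} (F : FiniteField card) where

  open FiniteField F

  commutativeRing : CommutativeRing 0ℓ 0ℓ
  commutativeRing = record { isCommutativeRing = isCommutativeRing }

  open CommutativeRing commutativeRing public
    using (+-assoc; +-comm; +-identityˡ; +-identityʳ; -‿inverseˡ; -‿inverseʳ; +-isAbelianGroup;
           *-assoc; *-comm; *-identityˡ; *-identityʳ; distribˡ; distribʳ; zeroˡ; zeroʳ)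
  open import Algebra.Properties.Ring (CommutativeRing.ring commutativeRing) public
    using (-1*x≈-x; -‿distribˡ-*; -‿distribʳ-*; -‿involutive; -0#≈0#)
  import Algebra.Properties.CommutativeSemiring.Exp (CommutativeRing.commutativeSemiring commutativeRing) as Exp
  open import Algebra.Properties.Semiring.Mult (CommutativeRing.semiring commutativeRing) public
    using (×-assoc-*; ×1-homo-*) renaming (_×_ to _⋅_)
  open import Algebra.Properties.Semiring.Sum (CommutativeRing.semiring commutativeRing) public
    using (sum; sum-cong-≗; sum-init-last; sum-replicate-zero; *-distribˡ-sum; ∑-distrib-+; ∑-comm)

  module ⊞ = Subgroups +-isAbelianGroup

  module RingSolver where
    open Solver (fromCommutativeRing commutativeRing (λ _ → nothing)) public
      renaming (_⊜_ to infix 4 _⊜_)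

  -- Elements are compared by their positions in the enumeration of the field.
  _≟_ : DecidableEquality Carrier
  x ≟ y = map′ to (cong (Any.index ∘ elements-complete))
               (Any.index (elements-complete x) Finₚ.≟ Any.index (elements-complete y))
    where
    to : Any.index (elements-complete x) ≡ Any.index (elements-complete y) → x ≡ y
    to eq = trans (Anyₚ.lookup-index (elements-complete x))
             (trans (cong (List.lookup elements) eq) (sym (Anyₚ.lookup-index (elements-complete y))))

  ^≡Exp : ∀ x n → x ^ n ≡ x Exp.^ n
  ^≡Exp x zero    = refl
  ^≡Exp x (suc n) = cong (x *_) (^≡Exp x n)

  ^-distrib-* : ∀ x y n → (x * y) ^ n ≡ x ^ n * y ^ n
  ^-distrib-* x y n = trans (^≡Exp _ n) (trans (Exp.^-distrib-* x y n) (sym (cong₂ _*_ (^≡Exp x n) (^≡Exp y n))))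

  ^-assocʳ : ∀ x m n → (x ^ m) ^ n ≡ x ^ (m ℕ.* n)
  ^-assocʳ x m n = trans (^≡Exp _ n) (trans (cong (Exp._^ n) (^≡Exp x m))
    (trans (Exp.^-assocʳ x m n) (sym (^≡Exp x (m ℕ.* n)))))

  *-cancelˡ : ∀ {a x y} → a ≢ 0# → a * x ≡ a * y → x ≡ y
  *-cancelˡ {a} {x} {y} a≢0 eq with inverse a a≢0
  ... | b , ab≡1 = trans (sym (undo x)) (trans (cong (b *_) eq) (undo y))
    where
    undo : ∀ z → b * (a * z) ≡ z
    undo z = trans (sym (*-assoc b a z)) (trans (cong (_* z) (trans (*-comm b a) ab≡1)) (*-identityˡ z))

  *-zero : ∀ {x y} → x * y ≡ 0# → x ≢ 0# → y ≡ 0#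
  *-zero {x} xy≡0 x≢0 = *-cancelˡ x≢0 (trans xy≡0 (sym (zeroʳ x)))

  *-≢0 : ∀ {x y} → x ≢ 0# → y ≢ 0# → x * y ≢ 0#
  *-≢0 x≢0 y≢0 xy≡0 = y≢0 (*-zero xy≡0 x≢0)

  ^-zero : ∀ {x} n → x ^ n ≡ 0# → x ≡ 0#
  ^-zero zero    1≡0 = contradiction 1≡0 1≢0
  ^-zero {x} (suc n) eq with x ≟ 0#
  ... | yes x≡0 = x≡0
  ... | no  x≢0 = ^-zero n (*-zero eq x≢0)

  nonzero : List Carrier
  nonzero = filter (λ x → ¬? (x ≟ 0#)) elements

  nonzero-unique : Unique nonzero
  nonzero-unique = Uniqueₚ.filter⁺ _ elements-unique

  ∈-nonzero⁺ : ∀ {x} → x ≢ 0# → x ∈ nonzero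
  ∈-nonzero⁺ {x} x≢0 = ∈-filter⁺ _ (elements-complete x) x≢0

  ∈-nonzero⁻ : ∀ {x} → x ∈ nonzero → x ≢ 0#
  ∈-nonzero⁻ x∈ = proj₂ (∈-filter⁻ _ {xs = elements} x∈)

  length-nonzero : suc (length nonzero) ≡ card
  length-nonzero = trans
    (≅-length (All.tabulate (λ { x∈ refl → ∈-nonzero⁻ x∈ refl }) AllPairs.∷ nonzero-unique) elements-unique
      ((λ _ → elements-complete _) , λ {x} _ → split x))
    elements-card
    where
    split : ∀ x → x ∈ (0# ∷ nonzero)
    split x with x ≟ 0#
    ... | yes x≡0 = here x≡0
    ... | no  x≢0 = there (∈-nonzero⁺ x≢0)

  ∏ : List Carrier → Carrier
  ∏ = foldr _*_ 1#

  ∏-↭ : ∀ {xs ys} → xs ↭ ys → ∏ xs ≡ ∏ ys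
  ∏-↭ xs↭ys = ↭ₛ.foldr-commMonoid (setoid Carrier)
                (CommutativeRing.*-isCommutativeMonoid commutativeRing) (↭⇒↭ₛ xs↭ys)

  ∏-scale : ∀ a xs → ∏ (List.map (a *_) xs) ≡ (a ^ length xs) * ∏ xs
  ∏-scale a []       = sym (*-identityˡ 1#)
  ∏-scale a (x ∷ xs) = trans (cong (a * x *_) (∏-scale a xs))
    (solve 4 (λ a x b y → (a ⊗ x) ⊗ (b ⊗ y) ⊜ (a ⊗ b) ⊗ (x ⊗ y)) refl a x (a ^ length xs) (∏ xs))
    where open RingSolver

  ∏-≢0 : ∀ {xs} → (∀ {x} → x ∈ xs → x ≢ 0#) → ∏ xs ≢ 0#
  ∏-≢0 {[]}     _  = 1≢0
  ∏-≢0 {x ∷ xs} ≢0 = *-≢0 (≢0 (here refl)) (∏-≢0 (≢0 ∘ there))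

  scale-nonzero : ∀ {a} → a ≢ 0# → List.map (a *_) nonzero ↭ nonzero
  scale-nonzero {a} a≢0 = ≅⇒↭ (Uniqueₚ.map⁺ (*-cancelˡ a≢0) nonzero-unique) nonzero-unique
    ((λ x∈ → image (∈-map⁻ (a *_) x∈)) , λ {x} x∈ → preimage x (∈-nonzero⁻ x∈) (inverse a a≢0))
    where
    image : ∀ {y} → (∃ λ x → x ∈ nonzero × y ≡ a * x) → y ∈ nonzero
    image (x , x∈ , refl) = ∈-nonzero⁺ (*-≢0 a≢0 (∈-nonzero⁻ x∈))
    preimage : ∀ x → x ≢ 0# → (Σ Carrier λ b → a * b ≡ 1#) → x ∈ List.map (a *_) nonzero
    preimage x x≢0 (b , ab≡1) = subst (_∈ _) eq
      (∈-map⁺ (a *_) (∈-nonzero⁺ λ bx≡0 → x≢0 (trans (sym eq) (trans (cong (a *_) bx≡0) (zeroʳ a)))))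
      where
      eq : a * (b * x) ≡ x
      eq = trans (sym (*-assoc a b x)) (trans (cong (_* x) ab≡1) (*-identityˡ x))

  -- Multiplication by a nonzero `x` permutes the nonzero elements; comparing their products before
  -- and after gives `x ^ (card - 1) = 1`.
  fermat : ∀ x → x ^ card ≡ x
  fermat x = subst (λ n → x ^ n ≡ x) length-nonzero (go (x ≟ 0#))
    where
    go : Dec (x ≡ 0#) → x * (x ^ length nonzero) ≡ x
    go (yes refl) = zeroˡ _
    go (no x≢0) = trans (cong (x *_) one) (*-identityʳ x)
      where
      open ≡-Reasoning
      one : x ^ length nonzero ≡ 1#
      one = *-cancelˡ (∏-≢0 ∈-nonzero⁻) (begin
        ∏ nonzero * (x ^ length nonzero) ≡⟨ *-comm _ _ ⟩
        (x ^ length nonzero) * ∏ nonzero ≡⟨ ∏-scale x nonzero ⟨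
        ∏ (List.map (x *_) nonzero)      ≡⟨ ∏-↭ (scale-nonzero x≢0) ⟩
        ∏ nonzero                        ≡⟨ *-identityʳ _ ⟨
        ∏ nonzero * 1#                   ∎)

  -- The additive counterpart: translation by `1#` permutes the field, and the sum of all elements
  -- grows by `card ⋅ 1#`.
  card⋅1≡0 : card ⋅ 1# ≡ 0#
  card⋅1≡0 = ⊞.∙-injective (⨁ elements) (begin
    ⨁ elements + card ⋅ 1#             ≡⟨ cong (λ n → ⨁ elements + n ⋅ 1#) elements-card ⟨
    ⨁ elements + length elements ⋅ 1#  ≡⟨ shift elements ⟨
    ⨁ (List.map (1# +_) elements)      ≡⟨ ↭ₛ.foldr-commMonoid (setoid Carrier)
                                            (CommutativeRing.+-isCommutativeMonoid commutativeRing) (↭⇒↭ₛ perm) ⟩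
    ⨁ elements                         ≡⟨ +-identityʳ _ ⟨
    ⨁ elements + 0#                    ∎)
    where
    open ≡-Reasoning
    ⨁ : List Carrier → Carrier
    ⨁ = foldr _+_ 0#
    shift : ∀ xs → ⨁ (List.map (1# +_) xs) ≡ ⨁ xs + length xs ⋅ 1#
    shift []       = sym (+-identityʳ 0#)
    shift (x ∷ xs) = trans (cong (1# + x +_) (shift xs))
      (solve 4 (λ o x s n → (o ⊕ x) ⊕ (s ⊕ n) ⊜ (x ⊕ s) ⊕ (o ⊕ n)) refl 1# x (⨁ xs) (length xs ⋅ 1#))
      where open RingSolver
    perm : List.map (1# +_) elements ↭ elements
    perm = ≅⇒↭ (Uniqueₚ.map⁺ (⊞.∙-injective 1#) elements-unique) elements-unique
      ((λ _ → elements-complete _) ,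
       λ {x} _ → subst (_∈ _) (⊞.∙-cancel′ 1# x) (∈-map⁺ (1# +_) (elements-complete _)))

  -- Roots of monic polynomials

  -- lower coefficients, constant term first; the leading coefficient 1 is implicit
  evalMonic : ∀ {d} → Vec Carrier d → Carrier → Carrier
  evalMonic []       x = 1#
  evalMonic (c ∷ cs) x = c + x * evalMonic cs x

  -- Division by X - r, with the point of evaluation written as `r + s` so that no subtraction
  -- enters the ring identities.
  factor : ∀ {d} (cs : Vec Carrier (suc d)) r → ∃ λ (ds : Vec Carrier d) →
           ∀ s → evalMonic cs (r + s) ≡ evalMonic cs r + s * evalMonic ds (r + s)
  factor (c ∷ []) r = [] , λ s →
    solve 4 (λ c s r o → c ⊕ (r ⊕ s) ⊗ o ⊜ (c ⊕ r ⊗ o) ⊕ s ⊗ o) refl c s r 1#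
    where open RingSolver
  factor (c ∷ cs@(_ ∷ _)) r with factor cs r
  -- Horner's scheme: the new coefficient of the quotient is the value at `r` of the polynomial
  -- without its constant term.
  ... | ds , eq = (evalMonic cs r ∷ ds) , λ s → trans (cong (λ y → c + (r + s) * y) (eq s))
    (solve 5 (λ c s r g h → c ⊕ (r ⊕ s) ⊗ (g ⊕ s ⊗ h) ⊜ (c ⊕ r ⊗ g) ⊕ s ⊗ (g ⊕ (r ⊕ s) ⊗ h)) refl
       c s r (evalMonic cs r) (evalMonic ds (r + s)))
    where open RingSolver

  -- By `factor`, any further root `x` has `s = x - r` different from 0 and is therefore a root of
  -- the quotient.
  roots-bound : ∀ {d} (cs : Vec Carrier d) {xs} → Unique xs →
                (∀ {x} → x ∈ xs → evalMonic cs x ≡ 0#) → length xs ≤ d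
  roots-bound cs {[]} _ _ = z≤n
  roots-bound [] {x ∷ xs} _ root = contradiction (root (here refl)) 1≢0
  roots-bound cs@(_ ∷ _) {r ∷ xs} (r∉ AllPairs.∷ xs!) root with factor cs r
  ... | ds , eq = s≤s (roots-bound ds xs! other)
    where
    open ≡-Reasoning
    other : ∀ {x} → x ∈ xs → evalMonic ds x ≡ 0#
    other {x} x∈ = subst (λ y → evalMonic ds y ≡ 0#) r+s≡x (*-zero (begin
      s * evalMonic ds (r + s)                    ≡⟨ +-identityˡ _ ⟨
      0# + s * evalMonic ds (r + s)               ≡⟨ cong (_+ s * evalMonic ds (r + s)) (root (here refl)) ⟨
      evalMonic cs r + s * evalMonic ds (r + s)   ≡⟨ eq s ⟨
      evalMonic cs (r + s)                        ≡⟨ cong (evalMonic cs) r+s≡x ⟩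
      evalMonic cs x                              ≡⟨ root (there x∈) ⟩
      0#                                          ∎)
      λ s≡0 → All.lookup r∉ x∈ (trans (sym (+-identityʳ r)) (trans (cong (r +_) (sym s≡0)) r+s≡x)))
      where
      s : Carrier
      s = - r + x
      r+s≡x : r + s ≡ x
      r+s≡x = ⊞.∙-cancel′ r x

  evalMonic-^ : ∀ d x → evalMonic (replicate d 0#) x ≡ x ^ d
  evalMonic-^ zero    x = refl
  evalMonic-^ (suc d) x = trans (+-identityˡ _) (cong (x *_) (evalMonic-^ d x))

  evalMonic-binomial : ∀ d t x → evalMonic (t ∷ replicate d 0#) x ≡ t + x ^ suc d
  evalMonic-binomial d t x = cong (λ y → t + x * y) (evalMonic-^ d x)

  evalMonic-trinomial : ∀ d b x → evalMonic (0# ∷ b ∷ replicate d 0#) x ≡ b * x + x ^ suc (suc d)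
  evalMonic-trinomial d b x = trans (+-identityˡ _) (trans (cong (x *_) (evalMonic-binomial d b x))
    (solve 3 (λ x b y → x ⊗ (b ⊕ y) ⊜ b ⊗ x ⊕ x ⊗ y) refl x b (x ^ suc d)))
    where open RingSolver

  -- The characteristic and the Frobenius map

  ⋅-annihilates : ∀ {p} → p ⋅ 1# ≡ 0# → ∀ {n} → p ∣ n → ∀ x → n ⋅ x ≡ 0#
  ⋅-annihilates {p} p1≡0 (divides c refl) x = begin
    (c ℕ.* p) ⋅ x           ≡⟨ cong ((c ℕ.* p) ⋅_) (*-identityˡ x) ⟨
    (c ℕ.* p) ⋅ (1# * x)    ≡⟨ ×-assoc-* (c ℕ.* p) 1# x ⟨
    ((c ℕ.* p) ⋅ 1#) * x    ≡⟨ cong (_* x) (×1-homo-* c p) ⟩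
    (c ⋅ 1# * p ⋅ 1#) * x   ≡⟨ cong (λ y → (c ⋅ 1# * y) * x) p1≡0 ⟩
    (c ⋅ 1# * 0#) * x       ≡⟨ cong (_* x) (zeroʳ _) ⟩
    0# * x                  ≡⟨ zeroˡ x ⟩
    0#                      ∎
    where open ≡-Reasoning

  -- In the binomial expansion all terms but the two outer ones have a coefficient divisible by `p`.
  frobenius-+ : ∀ {p} → Prime p → p ⋅ 1# ≡ 0# → ∀ x y → (x + y) ^ p ≡ x ^ p + y ^ p
  frobenius-+ {p@(suc m)} pr p1≡0 x y = begin
    (x + y) ^ p                              ≡⟨ trans (^≡Exp (x + y) p) (theorem p x y) ⟩
    term Fin.zero + sum (term ∘ Fin.suc)     ≡⟨ cong₂ _+_ first (sum-init-last (term ∘ Fin.suc)) ⟩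
    y ^ p + (sum middle + term (Fin.fromℕ p)) ≡⟨ cong₂ (λ a b → y ^ p + (a + b)) vanish lastTerm ⟩
    y ^ p + (0# + x ^ p)                     ≡⟨ cong (y ^ p +_) (+-identityˡ _) ⟩
    y ^ p + x ^ p                            ≡⟨ +-comm _ _ ⟩
    x ^ p + y ^ p                            ∎
    where
    open ≡-Reasoning
    open import Algebra.Properties.CommutativeSemiring.Binomial (CommutativeRing.commutativeSemiring commutativeRing)
    term : Fin (suc p) → Carrier
    term = binomialTerm x y p
    middle : Fin m → Carrier
    middle i = term (Fin.suc (Fin.inject₁ i))
    first : term Fin.zero ≡ y ^ p
    first = trans (+-identityʳ _) (trans (*-identityˡ _) (sym (^≡Exp y p)))
    lastTerm : term (Fin.fromℕ p) ≡ x ^ p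
    lastTerm = trans (cong (λ k → (p C k) ⋅ (x Exp.^ k * y Exp.^ (p ℕ.∸ k))) (Finₚ.toℕ-fromℕ p))
      (trans (cong₂ (λ c k → c ⋅ (x Exp.^ p * y Exp.^ k)) (nCn≡1 p) (ℕₚ.n∸n≡0 p))
             (trans (+-identityʳ _) (trans (*-identityʳ _) (sym (^≡Exp x p)))))
    vanish : sum middle ≡ 0#
    vanish = trans (sum-cong-≗ λ i → ⋅-annihilates p1≡0
        (prime∣C pr (s≤s z≤n) (s≤s (subst (ℕ._< m) (sym (Finₚ.toℕ-inject₁ i)) (Finₚ.toℕ<n i)))) _)
      (sum-replicate-zero m)

  frobenius-power-+ : ∀ {p} → Prime p → p ⋅ 1# ≡ 0# → ∀ e x y →
                      (x + y) ^ (p ℕ.^ e) ≡ x ^ (p ℕ.^ e) + y ^ (p ℕ.^ e)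
  frobenius-power-+ pr p1≡0 zero    x y = distribʳ 1# x y
  frobenius-power-+ {p} pr p1≡0 (suc e) x y = begin
    (x + y) ^ (p ℕ.* r)             ≡⟨ ^-assocʳ (x + y) p r ⟨
    ((x + y) ^ p) ^ r               ≡⟨ cong (_^ r) (frobenius-+ pr p1≡0 x y) ⟩
    (x ^ p + y ^ p) ^ r             ≡⟨ frobenius-power-+ pr p1≡0 e (x ^ p) (y ^ p) ⟩
    (x ^ p) ^ r + (y ^ p) ^ r       ≡⟨ cong₂ _+_ (^-assocʳ x p r) (^-assocʳ y p r) ⟩
    x ^ (p ℕ.* r) + y ^ (p ℕ.* r)   ∎
    where
    open ≡-Reasoning
    r : ℕ
    r = p ℕ.^ e

  -- The element `(p ⋅ 1#) ^ e` equals `card ⋅ 1#`, which is 0, and a field has no nilpotents.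
  characteristic : ∀ {p} e → card ≡ p ℕ.^ e → p ⋅ 1# ≡ 0#
  characteristic {p} e card≡ = ^-zero e (trans (sym (power e)) (trans (cong (_⋅ 1#) (sym card≡)) card⋅1≡0))
    where
    power : ∀ e → (p ℕ.^ e) ⋅ 1# ≡ (p ⋅ 1#) ^ e
    power zero    = +-identityʳ 1#
    power (suc e) = trans (×1-homo-* p (p ℕ.^ e)) (cong (p ⋅ 1# *_) (power e))

-- The conjugation x ↦ x ^ q of a field with q ^ 2 elements

primePower≥2 : ∀ {q} → IsPrimePower q → 2 ≤ q
primePower≥2 (p , e , pr , 1≤e , refl) = begin
  2       ≤⟨ ℕ.nonTrivial⇒n>1 p {{prime⇒nonTrivial pr}} ⟩
  p       ≡⟨ ℕₚ.*-identityʳ p ⟨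
  p ℕ.^ 1 ≤⟨ ℕₚ.^-monoʳ-≤ p {{prime⇒nonZero pr}} 1≤e ⟩
  p ℕ.^ e ∎
  where open ℕₚ.≤-Reasoning

module Conjugation {q : ℕ} (q-primePower : IsPrimePower q) (F : FiniteField (q ℕ.* q)) where

  open FiniteField F
  open FieldProperties F
  open Hermitian q F using (conj)

  2≤q : 2 ≤ q
  2≤q = primePower≥2 q-primePower

  -- For q = p^e, conjugation is the e-th iterate of the Frobenius map; the characteristic is p
  -- because the field has p^(e+e) elements.
  conj-+ : ∀ x y → conj (x + y) ≡ conj x + conj y
  conj-+ x y = let p , e , pr , _ , q≡p^e = q-primePower in
    subst (λ r → (x + y) ^ r ≡ x ^ r + y ^ r) (sym q≡p^e)
      (frobenius-power-+ pr
        (characteristic (e ℕ.+ e) (trans (cong₂ ℕ._*_ q≡p^e q≡p^e) (sym (ℕₚ.^-distribˡ-+-* p e e)))) e x y)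

  conj-* : ∀ x y → conj (x * y) ≡ conj x * conj y
  conj-* x y = ^-distrib-* x y q

  conj-involutive : ∀ x → conj (conj x) ≡ x
  conj-involutive x = trans (^-assocʳ x q q) (fermat x)

  conj-0 : conj 0# ≡ 0#
  conj-0 = ⊞.∙-injective (conj 0#) (trans (sym (conj-+ 0# 0#)) (trans (cong conj (+-identityˡ 0#)) (sym (+-identityʳ _))))

  conj-neg : ∀ x → conj (- x) ≡ - conj x
  conj-neg x = ⊞.∙-injective (conj x) (trans (sym (conj-+ x (- x)))
    (trans (cong conj (-‿inverseʳ x)) (trans conj-0 (sym (-‿inverseʳ (conj x))))))

  conj-≢0 : ∀ {x} → x ≢ 0# → conj x ≢ 0#
  conj-≢0 {x} x≢0 eq = x≢0 (trans (sym (conj-involutive x)) (trans (cong conj eq) conj-0))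

  conj-1 : conj 1# ≡ 1#
  conj-1 = *-cancelˡ (conj-≢0 1≢0) (trans (sym (conj-* 1# 1#)) (trans (cong conj (*-identityˡ 1#)) (sym (*-identityʳ _))))

  -- The polynomial b X + X^q has degree q, where `2 ≤ q` keeps the linear term below the leading
  -- one. The case b = 1 bounds the kernel of the trace, b = -1 the fixed field.
  conj-root-count : ∀ b {xs} → Unique xs → (∀ {x} → x ∈ xs → b * x + conj x ≡ 0#) → length xs ≤ q
  conj-root-count b = go 2≤q
    where
    go : ∀ {d} → 2 ≤ d → ∀ {xs} → Unique xs → (∀ {x} → x ∈ xs → b * x + x ^ d ≡ 0#) → length xs ≤ d
    go {suc (suc d)} (s≤s (s≤s _)) xs! root =
      roots-bound (0# ∷ b ∷ replicate d 0#) xs! λ {x} x∈ → trans (evalMonic-trinomial d b x) (root x∈)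

  q<q*q : q < q ℕ.* q
  q<q*q = ℕₚ.m<m*n q q {{ℕ.>-nonZero (ℕₚ.<-trans (s≤s z≤n) 2≤q)}} 2≤q

  -- For nonzero `z` the products `c * z` run through the whole field, so all q^2 elements would be
  -- roots of X + X^q.
  trace-nondegenerate : ∀ z → (∀ c → c * z + conj (c * z) ≡ 0#) → z ≡ 0#
  trace-nondegenerate z vanish with z ≟ 0#
  ... | yes z≡0 = z≡0
  ... | no  z≢0 = contradiction q<q*q (ℕₚ.≤⇒≯ (subst (ℕ._≤ q) elements-card
        (conj-root-count 1# elements-unique λ {x} _ → trans (cong (_+ conj x) (*-identityˡ x)) (traceless x (inverse z z≢0)))))
    where
    traceless : ∀ x → (Σ Carrier λ y → z * y ≡ 1#) → x + conj x ≡ 0#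
    traceless x (y , zy≡1) = subst (λ w → w + conj w ≡ 0#) eq (vanish (x * y))
      where
      eq : x * y * z ≡ x
      eq = trans (*-assoc x y z) (trans (cong (x *_) (trans (*-comm y z) zy≡1)) (*-identityʳ x))

  -- The norm onto the fixed field F_q

  norm : Carrier → Carrier
  norm c = c * conj c

  norm-≢0 : ∀ {c} → c ≢ 0# → norm c ≢ 0#
  norm-≢0 c≢0 = *-≢0 c≢0 (conj-≢0 c≢0)

  norm-* : ∀ x y → norm (x * y) ≡ norm x * norm y
  norm-* x y = trans (cong (x * y *_) (conj-* x y))
    (solve 4 (λ a b c d → (a ⊗ b) ⊗ (c ⊗ d) ⊜ (a ⊗ c) ⊗ (b ⊗ d)) refl x y (conj x) (conj y))
    where open RingSolver

  conj-norm : ∀ x → conj (norm x) ≡ norm x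
  conj-norm x = trans (conj-* x (conj x)) (trans (cong (conj x *_) (conj-involutive x)) (*-comm _ _))

  fixed : List Carrier
  fixed = filter (λ x → conj x ≟ x) elements

  fixed-unique : Unique fixed
  fixed-unique = Uniqueₚ.filter⁺ _ elements-unique

  ∈-fixed⁺ : ∀ {x} → conj x ≡ x → x ∈ fixed
  ∈-fixed⁺ {x} eq = ∈-filter⁺ _ (elements-complete x) eq

  ∈-fixed⁻ : ∀ {x} → x ∈ fixed → conj x ≡ x
  ∈-fixed⁻ x∈ = proj₂ (∈-filter⁻ _ {xs = elements} x∈)

  fixed≢0 : List Carrier
  fixed≢0 = filter (λ x → ¬? (x ≟ 0#)) fixed

  ∈-fixed≢0⁺ : ∀ {x} → conj x ≡ x → x ≢ 0# → x ∈ fixed≢0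
  ∈-fixed≢0⁺ eq x≢0 = ∈-filter⁺ _ (∈-fixed⁺ eq) x≢0

  ∈-fixed≢0⁻ : ∀ {x} → x ∈ fixed≢0 → conj x ≡ x × x ≢ 0#
  ∈-fixed≢0⁻ x∈ = ∈-fixed⁻ (proj₁ (∈-filter⁻ _ {xs = fixed} x∈)) , proj₂ (∈-filter⁻ _ {xs = fixed} x∈)

  fixed≢0-unique : Unique fixed≢0
  fixed≢0-unique = Uniqueₚ.filter⁺ _ fixed-unique

  length-fixed-suc : suc (length fixed≢0) ≡ length fixed
  length-fixed-suc = ≅-length
    (All.tabulate (λ { x∈ refl → proj₂ (∈-fixed≢0⁻ x∈) refl }) AllPairs.∷ fixed≢0-unique) fixed-unique
    ((λ { (here refl) → ∈-fixed⁺ conj-0 ; (there x∈) → ∈-fixed⁺ (proj₁ (∈-fixed≢0⁻ x∈)) }) , λ {x} → split x)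
    where
    split : ∀ x → x ∈ fixed → x ∈ (0# ∷ fixed≢0)
    split x x∈ with x ≟ 0#
    ... | yes x≡0 = here x≡0
    ... | no  x≢0 = there (∈-fixed≢0⁺ (∈-fixed⁻ x∈) x≢0)

  length-fixed≤q : length fixed ≤ q
  length-fixed≤q = conj-root-count (- 1#) fixed-unique λ {x} x∈ →
    trans (cong₂ _+_ (-1*x≈-x x) (∈-fixed⁻ x∈)) (-‿inverseˡ x)

  open Fibres _≟_ norm

  kernel-length : ℕ
  kernel-length = length (fibre nonzero 1#)

  -- The fibre is the multiplicative coset of the kernel by `c`. The argument of `image-kernel` is
  -- repeated here for nonzero elements, since `Subgroups` wants a group structure on the whole
  -- carrier.
  nonzero-fibre : ∀ {c} → c ∈ nonzero → length (fibre nonzero (norm c)) ≡ kernel-length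
  nonzero-fibre {c} c∈ = trans
    (≅-length (Uniqueₚ.filter⁺ _ nonzero-unique) (Uniqueₚ.map⁺ (*-cancelˡ c≢0) (Uniqueₚ.filter⁺ _ nonzero-unique))
      ((λ x∈ → from (inverse c c≢0) (∈-filter⁻ _ {xs = nonzero} x∈)) , λ x∈ → to (∈-map⁻ (c *_) x∈)))
    (Listₚ.length-map (c *_) (fibre nonzero 1#))
    where
    c≢0 : c ≢ 0#
    c≢0 = ∈-nonzero⁻ c∈
    to : ∀ {x} → (∃ λ y → y ∈ fibre nonzero 1# × x ≡ c * y) → x ∈ fibre nonzero (norm c)
    to (y , y∈ , refl) with ∈-filter⁻ _ {xs = nonzero} y∈
    ... | y∈nz , ny≡1 = ∈-filter⁺ _ (∈-nonzero⁺ (*-≢0 c≢0 (∈-nonzero⁻ y∈nz)))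
                          (trans (norm-* c y) (trans (cong (norm c *_) ny≡1) (*-identityʳ _)))
    from : ∀ {x} → (Σ Carrier λ b → c * b ≡ 1#) → x ∈ nonzero × norm x ≡ norm c → x ∈ List.map (c *_) (fibre nonzero 1#)
    from {x} (b , cb≡1) (x∈ , nx≡nc) = subst (_∈ _) c[bx]≡x
      (∈-map⁺ (c *_) (∈-filter⁺ _
        (∈-nonzero⁺ λ bx≡0 → ∈-nonzero⁻ x∈ (trans (sym c[bx]≡x) (trans (cong (c *_) bx≡0) (zeroʳ c))))
        (*-cancelˡ (norm-≢0 c≢0)
          (trans (sym (norm-* c (b * x))) (trans (cong norm c[bx]≡x) (trans nx≡nc (sym (*-identityʳ _))))))))
      where
      c[bx]≡x : c * (b * x) ≡ x
      c[bx]≡x = trans (sym (*-assoc c b x)) (trans (cong (_* x) cb≡1) (*-identityˡ x))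

  private
    norms : List Carrier
    norms = image nonzero

    norms⊆fixed≢0 : ∀ {t} → t ∈ norms → t ∈ fixed≢0
    norms⊆fixed≢0 t∈ with ∈-image⁻ nonzero t∈
    ... | c , c∈ , refl = ∈-fixed≢0⁺ (conj-norm c) (norm-≢0 (∈-nonzero⁻ c∈))

    norms≤fixed≢0 : length norms ≤ length fixed≢0
    norms≤fixed≢0 = Finite.⊆-length _≟_ (image-unique nonzero) fixed≢0-unique norms⊆fixed≢0

    fixed≢0<q : length fixed≢0 < q
    fixed≢0<q = subst (ℕ._≤ q) (sym length-fixed-suc) length-fixed≤q

    kernel-length≤ : kernel-length ≤ suc q
    kernel-length≤ = roots-bound (- 1# ∷ replicate q 0#) (Uniqueₚ.filter⁺ _ nonzero-unique) λ {x} x∈ →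
      trans (evalMonic-binomial q (- 1#) x)
        (trans (cong (- 1# +_) (proj₂ (∈-filter⁻ _ {xs = nonzero} x∈))) (-‿inverseˡ 1#))

    -- (q - 1)(q + 1) = |F*| = |norms| · |kernel|, and the root counts bound the two factors by q - 1 and q + 1.
    sharp : ∀ {a c m} → 0 < m → a ≤ m → c ≤ suc (suc m) → suc (a ℕ.* c) ≡ suc m ℕ.* suc m →
            a ≡ m × c ≡ suc (suc m)
    sharp {a} {c} {m@(suc _)} _ a≤m c≤ eq =
        ℕₚ.≤-antisym a≤m (ℕₚ.*-cancelʳ-≤ m a (suc (suc m))
           (subst (ℕ._≤ a ℕ.* suc (suc m)) eq′ (ℕₚ.*-monoʳ-≤ a c≤)))
      , ℕₚ.≤-antisym c≤ (ℕₚ.*-cancelˡ-≤ m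
           (subst (ℕ._≤ m ℕ.* c) eq′ (ℕₚ.*-monoˡ-≤ c a≤m)))
      where
      eq′ : a ℕ.* c ≡ m ℕ.* suc (suc m)
      eq′ = ℕₚ.suc-injective (trans eq (cong suc (sym (ℕₚ.*-suc m (suc m)))))

    sizes : suc (length norms) ≡ q × kernel-length ≡ suc q
    sizes = go q 2≤q (ℕₚ.≤-trans (s≤s norms≤fixed≢0) fixed≢0<q) kernel-length≤
                 (trans (cong suc (sym (uniform-fibres nonzero-fibre))) length-nonzero)
      where
      go : ∀ r {a c} → 2 ≤ r → a < r → c ≤ suc r → suc (a ℕ.* c) ≡ r ℕ.* r → suc a ≡ r × c ≡ suc r
      go (suc m) (s≤s 0<m) (s≤s a≤m) c≤ eq with sharp 0<m a≤m c≤ eq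
      ... | a≡m , c≡ = cong suc a≡m , c≡

  -- The lower bound comes from the q - 1 norms of nonzero elements, which are fixed and nonzero,
  -- together with 0.
  length-fixed : length fixed ≡ q
  length-fixed = ℕₚ.≤-antisym length-fixed≤q
    (subst₂ ℕ._≤_ (proj₁ sizes) length-fixed-suc (s≤s norms≤fixed≢0))

  -- By counting, the norms exhaust the nonzero fixed elements, so `t` is the norm of some `c` and
  -- its fibre is a coset of the kernel.
  norm-fibre : ∀ {t} → conj t ≡ t → t ≢ 0# → length (fibre elements t) ≡ suc q
  norm-fibre {t} t-fixed t≢0
    with ∈-image⁻ nonzero (Finite.⊆-reverse _≟_ (image-unique nonzero) fixed≢0-unique norms⊆fixed≢0
           (ℕₚ.≤-pred (subst (suc (length fixed≢0) ℕ.≤_) (sym (proj₁ sizes)) fixed≢0<q)) (∈-fixed≢0⁺ t-fixed t≢0))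
  ... | c , c∈ , refl = trans
    (≅-length (Uniqueₚ.filter⁺ _ elements-unique) (Uniqueₚ.filter⁺ _ nonzero-unique)
      ((λ x∈ → to (proj₂ (∈-filter⁻ _ {xs = elements} x∈))) ,
       λ x∈ → ∈-filter⁺ _ (elements-complete _) (proj₂ (∈-filter⁻ _ {xs = nonzero} x∈))))
    (trans (nonzero-fibre c∈) (proj₂ sizes))
    where
    to : ∀ {x} → norm x ≡ norm c → x ∈ fibre nonzero (norm c)
    to {x} eq = ∈-filter⁺ _ (∈-nonzero⁺ λ { refl → t≢0 (trans (sym eq) (zeroˡ _)) }) eq

  norm-fibre-0 : length (fibre elements 0#) ≡ 1
  norm-fibre-0 = ≅-length (Uniqueₚ.filter⁺ _ elements-unique) (All.[] AllPairs.∷ AllPairs.[])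
    ((λ x∈ → here (zero-norm (proj₂ (∈-filter⁻ _ {xs = elements} x∈)))) ,
     λ { (here refl) → ∈-filter⁺ _ (elements-complete 0#) (zeroˡ _) })
    where
    zero-norm : ∀ {x} → norm x ≡ 0# → x ≡ 0#
    zero-norm {x} eq with x ≟ 0#
    ... | yes x≡0 = x≡0
    ... | no  x≢0 = contradiction eq (norm-≢0 x≢0)

-- Isotropic vectors of hermitian forms

-- x ≡ y + (-1)^k z, without subtraction
Alternating : ℕ → ℕ → ℕ → ℕ → Set
Alternating k x y z = (k % 2 ≡ 0 → x ≡ y ℕ.+ z) × (k % 2 ≡ 1 → x ℕ.+ z ≡ y)

suc-even : ∀ k → suc k % 2 ≡ 0 → k % 2 ≡ 1
suc-even (suc zero)    _ = refl
suc-even (suc (suc k))   = suc-even k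

suc-odd : ∀ k → suc k % 2 ≡ 1 → k % 2 ≡ 0
suc-odd zero          _ = refl
suc-odd (suc (suc k))   = suc-odd k

module Forms {q : ℕ} (q-primePower : IsPrimePower q) (F : FiniteField (q ℕ.* q)) where

  open FiniteField F
  open FieldProperties F
  open Conjugation q-primePower F
  open Hermitian q F using (conj)

  -- axpy c u v stands for c u + v
  module HermitianForm
    {V : Set} (axpy : Carrier → V → V → V) (axpy-inverse : ∀ c u v → axpy (- c) u (axpy c u v) ≡ v)
    (⟨_,_⟩ : V → V → Carrier)
    (form-axpy : ∀ w c u v → ⟨ w , axpy c u v ⟩ ≡ c * ⟨ w , u ⟩ + ⟨ w , v ⟩)
    (form-sym : ∀ u v → ⟨ v , u ⟩ ≡ conj ⟨ u , v ⟩) where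

    isotropic : List V → List V
    isotropic = filter (λ w → ⟨ w , w ⟩ ≟ 0#)

    -- Closure under `axpy` is what the splitting uses; lengths of lists take the place of
    -- dimensions.
    record IsSubspace (W : List V) : Set where
      field
        unique : Unique W
        closed : ∀ c {u v} → u ∈ W → v ∈ W → axpy c u v ∈ W

    -- If all vectors are isotropic, the value of the form at `axpy c u v` is the trace of
    -- `c * ⟨ v , u ⟩`. It vanishes for every `c`, so `trace-nondegenerate` applies, in every
    -- characteristic.
    polarization : ∀ {W} → IsSubspace W → (∀ {w} → w ∈ W → ⟨ w , w ⟩ ≡ 0#) →
                   ∀ {u v} → u ∈ W → v ∈ W → ⟨ v , u ⟩ ≡ 0#
    polarization W≤ null {u} {v} u∈ v∈ = trace-nondegenerate ⟨ v , u ⟩ λ c →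
      trans (sym (expand c)) (null (IsSubspace.closed W≤ c u∈ v∈))
      where
      open ≡-Reasoning
      expand : ∀ c → let z = axpy c u v in ⟨ z , z ⟩ ≡ c * ⟨ v , u ⟩ + conj (c * ⟨ v , u ⟩)
      expand c = begin
        ⟨ z , z ⟩                     ≡⟨ form-axpy z c u v ⟩
        c * ⟨ z , u ⟩ + ⟨ z , v ⟩     ≡⟨ cong₂ (λ x y → c * x + y) (form-sym u z) (form-sym v z) ⟩
        c * conj ⟨ u , z ⟩ + conj ⟨ v , z ⟩
          ≡⟨ cong₂ (λ x y → c * conj x + conj y) (form-axpy u c u v) (form-axpy v c u v) ⟩
        c * conj (c * ⟨ u , u ⟩ + ⟨ u , v ⟩) + conj (c * ⟨ v , u ⟩ + ⟨ v , v ⟩)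
          ≡⟨ cong₂ (λ x y → c * conj (c * x + ⟨ u , v ⟩) + conj (c * ⟨ v , u ⟩ + y)) (null u∈) (null v∈) ⟩
        c * conj (c * 0# + ⟨ u , v ⟩) + conj (c * ⟨ v , u ⟩ + 0#)
          ≡⟨ cong₂ (λ x y → c * conj x + conj y)
               (trans (cong (_+ ⟨ u , v ⟩) (zeroʳ c)) (+-identityˡ _)) (+-identityʳ _) ⟩
        c * conj ⟨ u , v ⟩ + conj (c * ⟨ v , u ⟩)
          ≡⟨ cong (λ x → c * x + conj (c * ⟨ v , u ⟩)) (form-sym u v) ⟨
        c * ⟨ v , u ⟩ + conj (c * ⟨ v , u ⟩) ∎
        where
        z : V
        z = axpy c u v

    -- Splitting off a nonisotropic vector

    module Orthogonal {W : List V} (W≤ : IsSubspace W) {v : V} (v∈ : v ∈ W) (a≢0 : ⟨ v , v ⟩ ≢ 0#) where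

      open IsSubspace W≤

      a : Carrier
      a = ⟨ v , v ⟩

      conj-a : conj a ≡ a
      conj-a = sym (form-sym v v)

      v⊥ : List V
      v⊥ = filter (λ w → ⟨ v , w ⟩ ≟ 0#) W

      ∈-v⊥⁺ : ∀ {w} → w ∈ W → ⟨ v , w ⟩ ≡ 0# → w ∈ v⊥
      ∈-v⊥⁺ w∈ eq = ∈-filter⁺ _ w∈ eq

      ∈-v⊥⁻ : ∀ {w} → w ∈ v⊥ → w ∈ W × ⟨ v , w ⟩ ≡ 0#
      ∈-v⊥⁻ w∈ = ∈-filter⁻ _ {xs = W} w∈

      v⊥-subspace : IsSubspace v⊥
      v⊥-subspace = record
        { unique = Uniqueₚ.filter⁺ _ unique
        ; closed = λ c {u} {w} u∈ w∈ → ∈-v⊥⁺ (closed c (proj₁ (∈-v⊥⁻ u∈)) (proj₁ (∈-v⊥⁻ w∈)))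
            (trans (form-axpy v c u w)
              (trans (cong₂ (λ x y → c * x + y) (proj₂ (∈-v⊥⁻ u∈)) (proj₂ (∈-v⊥⁻ w∈)))
                     (trans (+-identityʳ _) (zeroʳ c))))
        }

      v⊥-smaller : length v⊥ < length W
      v⊥-smaller = Listₚ.filter-notAll _ W (lose v∈ a≢0)

      coordinate : ∀ c {w} → ⟨ v , w ⟩ ≡ 0# → ⟨ v , axpy c v w ⟩ ≡ c * a
      coordinate c {w} eq = trans (form-axpy v c v w) (trans (cong (c * a +_) eq) (+-identityʳ _))

      decompose : ∀ {w} → w ∈ W → ∃ λ c → ∃ λ w′ → w′ ∈ v⊥ × w ≡ axpy c v w′
      decompose {w} w∈ with inverse a a≢0
      ... | i , ai≡1 = c , axpy (- c) v w , ∈-v⊥⁺ (closed (- c) v∈ w∈) orth ,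
            sym (trans (cong (λ d → axpy d v (axpy (- c) v w)) (sym (-‿involutive c))) (axpy-inverse (- c) v w))
        where
        open ≡-Reasoning
        -- With `i` the inverse of `⟨ v , v ⟩`, this is the coefficient of the orthogonal projection
        -- of `w` to the line of `v`.
        c : Carrier
        c = ⟨ v , w ⟩ * i
        orth : ⟨ v , axpy (- c) v w ⟩ ≡ 0#
        orth = begin
          ⟨ v , axpy (- c) v w ⟩          ≡⟨ form-axpy v (- c) v w ⟩
          - c * a + ⟨ v , w ⟩             ≡⟨ cong (_+ ⟨ v , w ⟩) (-‿distribˡ-* c a) ⟨
          - (⟨ v , w ⟩ * i * a) + ⟨ v , w ⟩
            ≡⟨ cong (λ x → - x + ⟨ v , w ⟩) (trans (*-assoc ⟨ v , w ⟩ i a)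
                 (trans (cong (⟨ v , w ⟩ *_) (trans (*-comm i a) ai≡1)) (*-identityʳ _))) ⟩
          - ⟨ v , w ⟩ + ⟨ v , w ⟩         ≡⟨ -‿inverseˡ _ ⟩
          0#                              ∎

      combine : V × Carrier → V
      combine (w , c) = axpy c v w

      combine-injective : ∀ {x y} → x ∈ cartesianProduct v⊥ elements → y ∈ cartesianProduct v⊥ elements →
                          combine x ≡ combine y → x ≡ y
      combine-injective {w , c} {w′ , c′} x∈ y∈ eq = cong₂ _,_ w≡w′ c≡c′
        where
        orth : ∀ {w c} → (w , c) ∈ cartesianProduct v⊥ elements → ⟨ v , w ⟩ ≡ 0#
        orth p = proj₂ (∈-v⊥⁻ (proj₁ (∈-cartesianProduct⁻ v⊥ elements p)))
        c≡c′ : c ≡ c′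
        c≡c′ = *-cancelˡ a≢0 (trans (*-comm a c) (trans (sym (coordinate c (orth x∈)))
                 (trans (cong ⟨ v ,_⟩ eq) (trans (coordinate c′ (orth y∈)) (*-comm c′ a)))))
        w≡w′ : w ≡ w′
        w≡w′ = trans (sym (axpy-inverse c v w)) (trans (cong₂ (λ d → axpy (- d) v) c≡c′ eq) (axpy-inverse c′ v w′))

      -- The decomposition of `W` into the line of `v` and `v⊥`, in the form needed for counting: it
      -- yields both the size of `W` and the number of isotropic vectors.
      ∑-decompose : (f : V → ℕ) → ∑ W f ≡ ∑ v⊥ (λ w → ∑ elements (λ c → f (axpy c v w)))
      ∑-decompose f = begin
        ∑ W f                                            ≡⟨ ≅-∑ f unique (map-unique combine combine-injective
                                                              (Uniqueₚ.cartesianProduct⁺ (IsSubspace.unique v⊥-subspace) elements-unique))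
                                                              (to , from) ⟩
        ∑ (List.map combine (cartesianProduct v⊥ elements)) f ≡⟨ ∑-map combine (cartesianProduct v⊥ elements) f ⟩
        ∑ (cartesianProduct v⊥ elements) (f ∘ combine)   ≡⟨ ∑-cartesianProduct v⊥ elements (f ∘ combine) ⟩
        ∑ v⊥ (λ w → ∑ elements (λ c → f (axpy c v w)))   ∎
        where
        open ≡-Reasoning
        to : ∀ {w} → w ∈ W → w ∈ List.map combine (cartesianProduct v⊥ elements)
        to w∈ with decompose w∈
        ... | c , w′ , w′∈ , refl = ∈-map⁺ combine (∈-cartesianProduct⁺ w′∈ (elements-complete c))
        from : ∀ {w} → w ∈ List.map combine (cartesianProduct v⊥ elements) → w ∈ W
        from w∈ with ∈-map⁻ combine w∈
        ... | (w′ , c) , p , refl = closed c v∈ (proj₁ (∈-v⊥⁻ (proj₁ (∈-cartesianProduct⁻ v⊥ elements p))))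

      length-decompose : length W ≡ q ℕ.* q ℕ.* length v⊥
      length-decompose = begin
        length W                                  ≡⟨ trans (∑-const W 1) (ℕₚ.*-identityʳ _) ⟨
        ∑ W (λ _ → 1)                             ≡⟨ ∑-decompose (λ _ → 1) ⟩
        ∑ v⊥ (λ _ → ∑ elements (λ _ → 1))         ≡⟨ ∑-const v⊥ _ ⟩
        length v⊥ ℕ.* ∑ elements (λ _ → 1)        ≡⟨ cong (length v⊥ ℕ.*_)
                                                       (trans (∑-const elements 1) (trans (ℕₚ.*-identityʳ _) elements-card)) ⟩
        length v⊥ ℕ.* (q ℕ.* q)                   ≡⟨ ℕₚ.*-comm (length v⊥) (q ℕ.* q) ⟩
        q ℕ.* q ℕ.* length v⊥                     ∎
        where open ≡-Reasoning

      form-combine : ∀ c {w} → w ∈ v⊥ → let z = axpy c v w in ⟨ z , z ⟩ ≡ norm c * a + ⟨ w , w ⟩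
      form-combine c {w} w∈ = begin
        ⟨ z , z ⟩                            ≡⟨ form-axpy z c v w ⟩
        c * ⟨ z , v ⟩ + ⟨ z , w ⟩            ≡⟨ cong₂ (λ x y → c * x + y) (form-sym v z) (form-sym w z) ⟩
        c * conj ⟨ v , z ⟩ + conj ⟨ w , z ⟩  ≡⟨ cong₂ (λ x y → c * x + y) zv (cong conj wz) ⟩
        c * (conj c * a) + conj ⟨ w , w ⟩    ≡⟨ cong₂ _+_ (sym (*-assoc c (conj c) a)) (sym (form-sym w w)) ⟩
        norm c * a + ⟨ w , w ⟩               ∎
        where
        open ≡-Reasoning
        z : V
        z = axpy c v w
        vw : ⟨ v , w ⟩ ≡ 0#
        vw = proj₂ (∈-v⊥⁻ w∈)
        zv : conj ⟨ v , z ⟩ ≡ conj c * a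
        zv = trans (cong conj (coordinate c vw)) (trans (conj-* c a) (cong (conj c *_) conj-a))
        wv : ⟨ w , v ⟩ ≡ 0#
        wv = trans (form-sym v w) (trans (cong conj vw) conj-0)
        wz : ⟨ w , z ⟩ ≡ ⟨ w , w ⟩
        wz = trans (form-axpy w c v w) (trans (cong (λ x → c * x + ⟨ w , w ⟩) wv)
               (trans (cong (_+ ⟨ w , w ⟩) (zeroʳ c)) (+-identityˡ _)))

      -- The vector `axpy c v w` is isotropic exactly when `norm c` equals `t`, the negative of
      -- `⟨ w , w ⟩ / ⟨ v , v ⟩`, which is fixed by conjugation. There is one such `c` if `w` is
      -- isotropic and there are q + 1 otherwise; the added indicator makes the two cases one
      -- equation that can be summed.
      isotropic-fibre : ∀ {w} → w ∈ v⊥ →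
        ∑ elements (λ c → [ ⟨ axpy c v w , axpy c v w ⟩ ≟ 0# ]) ℕ.+ q ℕ.* [ ⟨ w , w ⟩ ≟ 0# ] ≡ suc q
      isotropic-fibre {w} w∈ with inverse a a≢0
      ... | i , ai≡1 = trans (cong (ℕ._+ q ℕ.* [ b ≟ 0# ]) fibre≡) (size (b ≟ 0#))
        where
        open Fibres _≟_ norm using (fibre)
        b t : Carrier
        b = ⟨ w , w ⟩
        t = - (i * b)

        at≡-b : t * a ≡ - b
        at≡-b = trans (sym (-‿distribˡ-* (i * b) a)) (cong -_
          (trans (*-comm (i * b) a) (trans (sym (*-assoc a i b)) (trans (cong (_* b) ai≡1) (*-identityˡ b)))))

        to : ∀ c → norm c * a + b ≡ 0# → norm c ≡ t
        to c eq = *-cancelˡ a≢0 (trans (*-comm a (norm c)) (trans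
          (⊞.∙-injective b (trans (+-comm b _) (trans eq (sym (-‿inverseʳ b)))))
          (trans (sym at≡-b) (*-comm t a))))

        from : ∀ c → norm c ≡ t → norm c * a + b ≡ 0#
        from c eq = trans (cong (_+ b) (trans (cong (_* a) eq) at≡-b)) (-‿inverseˡ b)

        fibre≡ : ∑ elements (λ c → [ ⟨ axpy c v w , axpy c v w ⟩ ≟ 0# ]) ≡ length (fibre elements t)
        fibre≡ = trans (sym (length-filter-∑ (λ c → ⟨ axpy c v w , axpy c v w ⟩ ≟ 0#) elements)) (cong length
          (Listₚ.filter-≐ _ _ ((λ {c} eq → to c (trans (sym (form-combine c w∈)) eq)) ,
                               (λ {c} eq → trans (form-combine c w∈) (from c eq))) elements))

        conj-i : conj i ≡ i
        conj-i = *-cancelˡ a≢0 (trans (cong (_* conj i) (sym conj-a)) (trans (sym (conj-* a i))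
                   (trans (cong conj ai≡1) (trans conj-1 (sym ai≡1)))))

        t-fixed : conj t ≡ t
        t-fixed = trans (conj-neg (i * b)) (cong -_ (trans (conj-* i b) (cong₂ _*_ conj-i (sym (form-sym w w)))))

        size : (d : Dec (b ≡ 0#)) → length (fibre elements t) ℕ.+ q ℕ.* [ d ] ≡ suc q
        size (yes b≡0) = cong₂ ℕ._+_
          (trans (cong (length ∘ fibre elements) (trans (cong (λ x → - (i * x)) b≡0) (trans (cong -_ (zeroʳ i)) -0#≈0#))) norm-fibre-0)
          (ℕₚ.*-identityʳ q)
        size (no b≢0) = trans (cong₂ ℕ._+_ (norm-fibre t-fixed t≢0) (ℕₚ.*-zeroʳ q)) (ℕₚ.+-identityʳ (suc q))
          where
          t≢0 : t ≢ 0#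
          t≢0 t≡0 = b≢0 (trans (sym (-‿involutive b)) (trans (cong -_ (trans (sym at≡-b) (trans (cong (_* a) t≡0) (zeroˡ a)))) -0#≈0#))

      -- With |W| = q^2 |v⊥| this is the recursion of the overview: q Z(W) - |W| is -q times q Z(v⊥)
      -- - |v⊥|.
      length-isotropic : length (isotropic W) ℕ.+ q ℕ.* length (isotropic v⊥) ≡ length v⊥ ℕ.+ q ℕ.* length v⊥
      length-isotropic = begin
        length (isotropic W) ℕ.+ q ℕ.* length (isotropic v⊥)
          ≡⟨ cong₂ (λ x y → x ℕ.+ q ℕ.* y) (length-filter-∑ (λ w → ⟨ w , w ⟩ ≟ 0#) W) (length-filter-∑ (λ w → ⟨ w , w ⟩ ≟ 0#) v⊥) ⟩
        ∑ W null ℕ.+ q ℕ.* ∑ v⊥ null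
          ≡⟨ cong₂ ℕ._+_ (∑-decompose null) (sym (∑-* v⊥ q null)) ⟩
        ∑ v⊥ (λ w → ∑ elements (λ c → null (axpy c v w))) ℕ.+ ∑ v⊥ (λ w → q ℕ.* null w)
          ≡⟨ ∑-+ v⊥ _ _ ⟨
        ∑ v⊥ (λ w → ∑ elements (λ c → null (axpy c v w)) ℕ.+ q ℕ.* null w)
          ≡⟨ ∑-cong v⊥ isotropic-fibre ⟩
        ∑ v⊥ (λ _ → suc q)           ≡⟨ ∑-const v⊥ (suc q) ⟩
        length v⊥ ℕ.* suc q          ≡⟨ ℕₚ.*-comm (length v⊥) (suc q) ⟩
        length v⊥ ℕ.+ q ℕ.* length v⊥ ∎
        where
        open ≡-Reasoning
        null : V → ℕ
        null w = [ ⟨ w , w ⟩ ≟ 0# ]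

    -- A relation between two lists rather than a function of `W`, so that one list `R` can serve as
    -- the radical of all the spaces met in the induction.
    IsRadical : List V → List V → Set
    IsRadical R W = ∀ {w} → (w ∈ R → w ∈ W × (∀ {u} → u ∈ W → ⟨ u , w ⟩ ≡ 0#)) ×
                            (w ∈ W → (∀ {u} → u ∈ W → ⟨ u , w ⟩ ≡ 0#) → w ∈ R)

    -- Here `k` is the number of vectors split off. The first component is there to identify `k`
    -- with the rank later on.
    IsotropicCount : ℕ → List V → List V → Set
    IsotropicCount k R W = length W ≡ (q ℕ.* q) ℕ.^ k ℕ.* length R ×
      Alternating k (q ℕ.* length (isotropic W)) (length W) (q ℕ.^ k ℕ.* (pred q ℕ.* length R))

    -- Nonisotropic vectors are split off until none is left; by `polarization` the remaining space
    -- is then its own radical. The bound on the length of `W` makes the recursion structural.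
    isotropic-count : ∀ {R W} → Unique R → IsSubspace W → IsRadical R W → ∃ λ k → IsotropicCount k R W
    isotropic-count {R} R! W≤ rad = go _ W≤ rad ℕₚ.≤-refl
      where
      go : ∀ bound {W} → IsSubspace W → IsRadical R W → length W ≤ bound → ∃ λ k → IsotropicCount k R W
      go bound {W} W≤ rad ≤bound with Any.any? (λ w → ¬? (⟨ w , w ⟩ ≟ 0#)) W
      ... | no none = 0 , trans W≡R (sym (ℕₚ.*-identityˡ _)) , (λ _ → base) , λ ()
        where
        open ≡-Reasoning
        null : ∀ {w} → w ∈ W → ⟨ w , w ⟩ ≡ 0#
        null {w} w∈ = decidable-stable (⟨ w , w ⟩ ≟ 0#) λ ≢0 → none (lose w∈ ≢0)
        W≡R : length W ≡ length R
        W≡R = ≅-length (IsSubspace.unique W≤) R!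
                ((λ w∈ → proj₂ rad w∈ λ u∈ → polarization W≤ null w∈ u∈) , λ w∈ → proj₁ (proj₁ rad w∈))
        instance
          q≢0 : ℕ.NonZero q
          q≢0 = ℕ.>-nonZero (ℕₚ.<-trans (s≤s z≤n) 2≤q)
        base : q ℕ.* length (isotropic W) ≡ length W ℕ.+ 1 ℕ.* (pred q ℕ.* length R)
        base = begin
          q ℕ.* length (isotropic W)               ≡⟨ cong (λ l → q ℕ.* length l) (Listₚ.filter-all _ (All.tabulate null)) ⟩
          q ℕ.* length W                           ≡⟨ cong (ℕ._* length W) (ℕₚ.suc-pred q) ⟨
          length W ℕ.+ pred q ℕ.* length W         ≡⟨ cong (λ r → length W ℕ.+ pred q ℕ.* r) W≡R ⟩
          length W ℕ.+ pred q ℕ.* length R         ≡⟨ cong (length W ℕ.+_) (ℕₚ.*-identityˡ _) ⟨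
          length W ℕ.+ 1 ℕ.* (pred q ℕ.* length R) ∎
      -- A list that contains a nonisotropic vector is not empty, so the bound cannot be 0.
      go zero {_ ∷ _} W≤ rad () | yes _
      go (suc bound) {W} W≤ rad ≤bound | yes some with find some
      ... | v , v∈ , a≢0 = step (go bound v⊥-subspace v⊥-radical (ℕₚ.≤-pred (ℕₚ.≤-trans v⊥-smaller ≤bound)))
        where
        open Orthogonal W≤ v∈ a≢0
        open ≡-Reasoning

        -- The radical of `W` is orthogonal to `v`, so it lies in `v⊥`; conversely, a vector of `v⊥`
        -- orthogonal to `v⊥` is orthogonal to `v` as well, hence to all of `W`.
        v⊥-radical : IsRadical R v⊥
        v⊥-radical {w} = to , from
          where
          to : w ∈ R → w ∈ v⊥ × (∀ {u} → u ∈ v⊥ → ⟨ u , w ⟩ ≡ 0#)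
          to w∈ with proj₁ rad w∈
          ... | w∈W , orth = ∈-v⊥⁺ w∈W (orth v∈) , λ u∈ → orth (proj₁ (∈-v⊥⁻ u∈))
          from : w ∈ v⊥ → (∀ {u} → u ∈ v⊥ → ⟨ u , w ⟩ ≡ 0#) → w ∈ R
          from w∈ orth = proj₂ rad (proj₁ (∈-v⊥⁻ w∈)) orth′
            where
            orth′ : ∀ {u} → u ∈ W → ⟨ u , w ⟩ ≡ 0#
            orth′ {u} u∈ with decompose u∈
            ... | c , u′ , u′∈ , refl = begin
              ⟨ axpy c v u′ , w ⟩                  ≡⟨ form-sym w _ ⟩
              conj ⟨ w , axpy c v u′ ⟩             ≡⟨ cong conj (form-axpy w c v u′) ⟩
              conj (c * ⟨ w , v ⟩ + ⟨ w , u′ ⟩)    ≡⟨ cong₂ (λ x y → conj (c * x + y))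
                                                        (zero-sym (proj₂ (∈-v⊥⁻ w∈))) (zero-sym (orth u′∈)) ⟩
              conj (c * 0# + 0#)                   ≡⟨ cong conj (trans (+-identityʳ _) (zeroʳ c)) ⟩
              conj 0#                              ≡⟨ conj-0 ⟩
              0#                                   ∎
              where
              zero-sym : ∀ {x y} → ⟨ x , y ⟩ ≡ 0# → ⟨ y , x ⟩ ≡ 0#
              zero-sym {x} {y} eq = trans (form-sym x y) (trans (cong conj eq) conj-0)

        step : (∃ λ k → IsotropicCount k R v⊥) → ∃ λ k → IsotropicCount k R W
        step (k , order , even , odd) = suc k ,
          trans length-decompose (trans (cong (q ℕ.* q ℕ.*_) order) (sym (ℕₚ.*-assoc (q ℕ.* q) _ _))) ,
          (λ par → from-odd (odd (suc-even k par))) , (λ par → from-even (even (suc-odd k par)))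
          where
          Z Z′ W′ X : ℕ
          Z = length (isotropic W)
          Z′ = length (isotropic v⊥)
          W′ = length v⊥
          X = q ℕ.^ k ℕ.* (pred q ℕ.* length R)

          X-suc : q ℕ.* q ℕ.^ k ℕ.* (pred q ℕ.* length R) ≡ q ℕ.* X
          X-suc = ℕₚ.*-assoc q _ _

          W≡ : length W ≡ q ℕ.* (q ℕ.* W′)
          W≡ = trans length-decompose (ℕₚ.*-assoc q q W′)

          from-odd : q ℕ.* Z′ ℕ.+ X ≡ W′ → q ℕ.* Z ≡ length W ℕ.+ q ℕ.* q ℕ.^ k ℕ.* (pred q ℕ.* length R)
          from-odd eq = begin
            q ℕ.* Z                            ≡⟨ cong (q ℕ.*_) Z≡ ⟩
            q ℕ.* (q ℕ.* W′ ℕ.+ X)             ≡⟨ ℕₚ.*-distribˡ-+ q (q ℕ.* W′) X ⟩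
            q ℕ.* (q ℕ.* W′) ℕ.+ q ℕ.* X       ≡⟨ cong₂ ℕ._+_ W≡ X-suc ⟨
            length W ℕ.+ q ℕ.* q ℕ.^ k ℕ.* (pred q ℕ.* length R) ∎
            where
            -- Substituting `q Z′ + X` for `W′` produces the left-hand side of `length-isotropic`;
            -- the common summand `W′` then cancels, so the sign flips without any subtraction.
            Z≡ : Z ≡ q ℕ.* W′ ℕ.+ X
            Z≡ = ℕₚ.+-cancelˡ-≡ W′ _ _ (begin
              W′ ℕ.+ Z                     ≡⟨ ℕₚ.+-comm W′ Z ⟩
              Z ℕ.+ W′                     ≡⟨ cong (Z ℕ.+_) eq ⟨
              Z ℕ.+ (q ℕ.* Z′ ℕ.+ X)       ≡⟨ ℕₚ.+-assoc Z _ X ⟨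
              Z ℕ.+ q ℕ.* Z′ ℕ.+ X         ≡⟨ cong (ℕ._+ X) length-isotropic ⟩
              W′ ℕ.+ q ℕ.* W′ ℕ.+ X        ≡⟨ ℕₚ.+-assoc W′ _ X ⟩
              W′ ℕ.+ (q ℕ.* W′ ℕ.+ X)      ∎)

          from-even : q ℕ.* Z′ ≡ W′ ℕ.+ X → q ℕ.* Z ℕ.+ q ℕ.* q ℕ.^ k ℕ.* (pred q ℕ.* length R) ≡ length W
          from-even eq = begin
            q ℕ.* Z ℕ.+ q ℕ.* q ℕ.^ k ℕ.* (pred q ℕ.* length R) ≡⟨ cong (q ℕ.* Z ℕ.+_) X-suc ⟩
            q ℕ.* Z ℕ.+ q ℕ.* X            ≡⟨ ℕₚ.*-distribˡ-+ q Z X ⟨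
            q ℕ.* (Z ℕ.+ X)                ≡⟨ cong (q ℕ.*_) ZX≡ ⟩
            q ℕ.* (q ℕ.* W′)               ≡⟨ W≡ ⟨
            length W                       ∎
            where
            ZX≡ : Z ℕ.+ X ≡ q ℕ.* W′
            ZX≡ = ℕₚ.+-cancelˡ-≡ W′ _ _ (begin
              W′ ℕ.+ (Z ℕ.+ X)             ≡⟨ ℕₚ.+-assoc W′ Z X ⟨
              W′ ℕ.+ Z ℕ.+ X               ≡⟨ cong (ℕ._+ X) (ℕₚ.+-comm W′ Z) ⟩
              Z ℕ.+ W′ ℕ.+ X               ≡⟨ ℕₚ.+-assoc Z W′ X ⟩
              Z ℕ.+ (W′ ℕ.+ X)             ≡⟨ cong (Z ℕ.+_) eq ⟨
              Z ℕ.+ q ℕ.* Z′               ≡⟨ length-isotropic ⟩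
              W′ ℕ.+ q ℕ.* W′              ∎)

-- Matrices and rank

^-injective : ∀ {b} → 1 < b → ∀ {m n} → b ℕ.^ m ≡ b ℕ.^ n → m ≡ n
^-injective {b} 1<b {m} {n} eq with ℕₚ.<-cmp m n
... | tri≈ _ m≡n _ = m≡n
... | tri< m<n _ _ = contradiction eq (ℕₚ.<⇒≢ (ℕₚ.^-monoʳ-< b 1<b m<n))
... | tri> _ _ n<m = contradiction (sym eq) (ℕₚ.<⇒≢ (ℕₚ.^-monoʳ-< b 1<b n<m))

length-cartesianProduct : ∀ {A B : Set} (xs : List A) (ys : List B) → length (cartesianProduct xs ys) ≡ length xs ℕ.* length ys
length-cartesianProduct xs ys = begin
  length (cartesianProduct xs ys)      ≡⟨ trans (∑-const (cartesianProduct xs ys) 1) (ℕₚ.*-identityʳ _) ⟨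
  ∑ (cartesianProduct xs ys) (λ _ → 1) ≡⟨ ∑-cartesianProduct xs ys (λ _ → 1) ⟩
  ∑ xs (λ _ → ∑ ys (λ _ → 1))          ≡⟨ ∑-const xs _ ⟩
  length xs ℕ.* ∑ ys (λ _ → 1)         ≡⟨ cong (length xs ℕ.*_) (trans (∑-const ys 1) (ℕₚ.*-identityʳ _)) ⟩
  length xs ℕ.* length ys              ∎
  where open ≡-Reasoning

allVecs : List A → ∀ n → List (Vec A n)
allVecs xs zero    = [] ∷ []
allVecs xs (suc n) = List.map (uncurry _∷_) (cartesianProduct xs (allVecs xs n))

allVecs-unique : ∀ {xs : List A} → Unique xs → ∀ n → Unique (allVecs xs n)
allVecs-unique xs! zero    = All.[] AllPairs.∷ AllPairs.[]
allVecs-unique xs! (suc n) = Uniqueₚ.map⁺ (λ { refl → refl }) (Uniqueₚ.cartesianProduct⁺ xs! (allVecs-unique xs! n))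

allVecs-complete : ∀ {xs : List A} → (∀ x → x ∈ xs) → ∀ {n} (v : Vec A n) → v ∈ allVecs xs n
allVecs-complete all []      = here refl
allVecs-complete all (x ∷ v) = ∈-map⁺ (uncurry _∷_) (∈-cartesianProduct⁺ (all x) (allVecs-complete all v))

length-allVecs : ∀ (xs : List A) n → length (allVecs xs n) ≡ length xs ℕ.^ n
length-allVecs xs zero    = refl
length-allVecs xs (suc n) = begin
  length (allVecs xs (suc n))                   ≡⟨ Listₚ.length-map (uncurry _∷_) (cartesianProduct xs (allVecs xs n)) ⟩
  length (cartesianProduct xs (allVecs xs n))   ≡⟨ length-cartesianProduct xs (allVecs xs n) ⟩
  length xs ℕ.* length (allVecs xs n)           ≡⟨ cong (length xs ℕ.*_) (length-allVecs xs n) ⟩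
  length xs ℕ.* length xs ℕ.^ n                 ∎
  where open ≡-Reasoning

lookup-ext : ∀ {n} {u v : Vec A n} → (∀ i → lookup u i ≡ lookup v i) → u ≡ v
lookup-ext {u = u} {v} eq = trans (sym (Vecₚ.tabulate∘lookup u)) (trans (Vecₚ.tabulate-cong eq) (Vecₚ.tabulate∘lookup v))

-- Used twice: for vectors over the field, and for matrices as vectors of rows.
vec-isAbelianGroup : ∀ {_∙_ : A → A → A} {ε _⁻¹} → IsAbelianGroup _≡_ _∙_ ε _⁻¹ →
                     ∀ n → IsAbelianGroup _≡_ (zipWith {n = n} _∙_) (replicate n ε) (Vec.map _⁻¹)
vec-isAbelianGroup {_∙_ = _∙_} isAG n = record
  { isGroup = record
    { isMonoid = record
      { isSemigroup = record
        { isMagma = record { isEquivalence = isEquivalence ; ∙-cong = cong₂ (zipWith _∙_) }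
        ; assoc = Vecₚ.zipWith-assoc assoc }
      ; identity = Vecₚ.zipWith-identityˡ identityˡ , Vecₚ.zipWith-identityʳ identityʳ }
    ; inverse = Vecₚ.zipWith-inverseˡ inverseˡ , Vecₚ.zipWith-inverseʳ inverseʳ
    ; ⁻¹-cong = cong (Vec.map _) }
  ; comm = Vecₚ.zipWith-comm comm }
  where open IsAbelianGroup isAG using (assoc; identityˡ; identityʳ; inverseˡ; inverseʳ; comm)

module Matrices {q : ℕ} (q-primePower : IsPrimePower q) (F : FiniteField (q ℕ.* q)) where

  open FiniteField F
  open FieldProperties F
  open Conjugation q-primePower F
  open Hermitian q F

  infixl 6 _⊞_
  infixr 7 _·_

  _⊞_ : ∀ {n} → Vec Carrier n → Vec Carrier n → Vec Carrier n
  _⊞_ = zipWith _+_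

  _·_ : ∀ {n} → Carrier → Vec Carrier n → Vec Carrier n
  a · v = Vec.map (a *_) v

  𝟎 : ∀ {n} → Vec Carrier n
  𝟎 {n} = replicate n 0#

  axpy : ∀ {n} → Carrier → Vec Carrier n → Vec Carrier n → Vec Carrier n
  axpy c u v = c · u ⊞ v

  vectorGroup : ∀ n → IsAbelianGroup _≡_ (_⊞_ {n}) 𝟎 (Vec.map (-_))
  vectorGroup = vec-isAbelianGroup +-isAbelianGroup

  matrixGroup : ∀ n → IsAbelianGroup _≡_ (_⊕_ {n}) zeroMat (Vec.map (Vec.map (-_)))
  matrixGroup n = vec-isAbelianGroup (vectorGroup n) n

  vectors : ∀ n → List (Vec Carrier n)
  vectors = allVecs elements

  vectors-unique : ∀ n → Unique (vectors n)
  vectors-unique = allVecs-unique elements-unique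

  vectors-complete : ∀ {n} (v : Vec Carrier n) → v ∈ vectors n
  vectors-complete = allVecs-complete elements-complete

  length-vectors : ∀ n → length (vectors n) ≡ (q ℕ.* q) ℕ.^ n
  length-vectors n = trans (length-allVecs elements n) (cong (ℕ._^ n) elements-card)

  _≟ᵛ_ : ∀ {n} → DecidableEquality (Vec Carrier n)
  _≟ᵛ_ = Vecₚ.≡-dec _≟_

  lookup-axpy : ∀ {n} c (u v : Vec Carrier n) i → lookup (axpy c u v) i ≡ c * lookup u i + lookup v i
  lookup-axpy c u v i = trans (Vecₚ.lookup-zipWith _+_ i (c · u) v) (cong (_+ lookup v i) (Vecₚ.lookup-map i (c *_) u))

  axpy-inverse : ∀ {n} c (u v : Vec Carrier n) → axpy (- c) u (axpy c u v) ≡ v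
  axpy-inverse c u v = lookup-ext λ i → begin
    lookup (axpy (- c) u (axpy c u v)) i              ≡⟨ lookup-axpy (- c) u (axpy c u v) i ⟩
    - c * lookup u i + lookup (axpy c u v) i          ≡⟨ cong₂ _+_ (sym (-‿distribˡ-* c (lookup u i))) (lookup-axpy c u v i) ⟩
    - (c * lookup u i) + (c * lookup u i + lookup v i) ≡⟨ ⊞.∙-cancel _ _ ⟩
    lookup v i                                        ∎
    where open ≡-Reasoning

  lookup-lincomb : ∀ {n} r c (w : Fin r → Vec Carrier n) i →
                   lookup (lincomb r c w) i ≡ sum (λ j → c j * lookup (w j) i)
  lookup-lincomb zero    c w i = Vecₚ.lookup-replicate i 0#
  lookup-lincomb (suc r) c w i = trans (lookup-axpy (c Fin.zero) (w Fin.zero) _ i)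
    (cong (c Fin.zero * lookup (w Fin.zero) i +_) (lookup-lincomb r (c ∘ Fin.suc) (w ∘ Fin.suc) i))

  lincomb-cong : ∀ {n} r {c d} {v w : Fin r → Vec Carrier n} → (∀ i → c i ≡ d i) → (∀ i → v i ≡ w i) →
                 lincomb r c v ≡ lincomb r d w
  lincomb-cong zero    c≗d v≗w = refl
  lincomb-cong (suc r) c≗d v≗w = cong₂ _⊞_ (cong₂ _·_ (c≗d Fin.zero) (v≗w Fin.zero))
                                   (lincomb-cong r (c≗d ∘ Fin.suc) (v≗w ∘ Fin.suc))

  -- The coefficients form a vector instead of a function, so that they can be enumerated and
  -- compared without function extensionality.
  combination : ∀ {n r} → (Fin r → Vec Carrier n) → Vec Carrier r → Vec Carrier n
  combination {r = r} w c = lincomb r (lookup c) w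

  combination-axpy : ∀ {n r} (w : Fin r → Vec Carrier n) a c d →
                     combination w (axpy a c d) ≡ axpy a (combination w c) (combination w d)
  combination-axpy {r = r} w a c d = lookup-ext λ i → begin
    lookup (combination w (axpy a c d)) i
      ≡⟨ lookup-lincomb r (lookup (axpy a c d)) w i ⟩
    sum (λ j → lookup (axpy a c d) j * lookup (w j) i)
      ≡⟨ sum-cong-≗ (λ j → trans (cong (_* lookup (w j) i) (lookup-axpy a c d j)) (expand (lookup c j) (lookup d j) (lookup (w j) i))) ⟩
    sum (λ j → a * (lookup c j * lookup (w j) i) + lookup d j * lookup (w j) i)
      ≡⟨ ∑-distrib-+ (λ j → a * (lookup c j * lookup (w j) i)) (λ j → lookup d j * lookup (w j) i) ⟩
    sum (λ j → a * (lookup c j * lookup (w j) i)) + sum (λ j → lookup d j * lookup (w j) i)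
      ≡⟨ cong (_+ sum (λ j → lookup d j * lookup (w j) i)) (*-distribˡ-sum a (λ j → lookup c j * lookup (w j) i)) ⟨
    a * sum (λ j → lookup c j * lookup (w j) i) + sum (λ j → lookup d j * lookup (w j) i)
      ≡⟨ cong₂ (λ x y → a * x + y) (lookup-lincomb r (lookup c) w i) (lookup-lincomb r (lookup d) w i) ⟨
    a * lookup (combination w c) i + lookup (combination w d) i
      ≡⟨ lookup-axpy a (combination w c) (combination w d) i ⟨
    lookup (axpy a (combination w c) (combination w d)) i ∎
    where
    open ≡-Reasoning
    expand : ∀ x y z → (a * x + y) * z ≡ a * (x * z) + y * z
    expand x y z = trans (distribʳ z (a * x) y) (cong (_+ y * z) (*-assoc a x z))

  1·v≡v : ∀ {n} (v : Vec Carrier n) → 1# · v ≡ v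
  1·v≡v v = trans (Vecₚ.map-cong *-identityˡ v) (Vecₚ.map-id v)

  combination-⊞ : ∀ {n r} (w : Fin r → Vec Carrier n) c d → combination w (c ⊞ d) ≡ combination w c ⊞ combination w d
  combination-⊞ w c d = trans (cong (λ x → combination w (x ⊞ d)) (sym (1·v≡v c)))
    (trans (combination-axpy w 1# c d) (cong (_⊞ combination w d) (1·v≡v (combination w c))))

  combination-𝟎 : ∀ {n r} (w : Fin r → Vec Carrier n) → combination w 𝟎 ≡ 𝟎
  combination-𝟎 {r = zero}  w = refl
  combination-𝟎 {r = suc r} w = lookup-ext λ i → trans (lookup-axpy 0# (w Fin.zero) (combination (w ∘ Fin.suc) 𝟎) i)
    (trans (cong₂ _+_ (zeroˡ _) (cong (λ v → lookup v i) (combination-𝟎 (w ∘ Fin.suc)))) (+-identityˡ _))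

  combination-lincomb : ∀ {n r} (w : Fin r → Vec Carrier n) s c (d : Fin s → Vec Carrier r) →
                        combination w (lincomb s c d) ≡ lincomb s c (combination w ∘ d)
  combination-lincomb w zero    c d = combination-𝟎 w
  combination-lincomb w (suc s) c d = trans (combination-axpy w (c Fin.zero) (d Fin.zero) _)
    (cong (axpy (c Fin.zero) (combination w (d Fin.zero))) (combination-lincomb w s (c ∘ Fin.suc) (d ∘ Fin.suc)))

  unit : ∀ {n} → Fin n → Vec Carrier n
  unit Fin.zero    = 1# ∷ 𝟎
  unit (Fin.suc i) = 0# ∷ unit i

  sum-zero : ∀ {n} (f : Fin n → Carrier) → (∀ i → f i ≡ 0#) → sum f ≡ 0#
  sum-zero {n} f f≡0 = trans (sum-cong-≗ f≡0) (sum-replicate-zero n)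

  -- The parameter `g` is the identity for `combination-unit` and conjugation for
  -- `form-nondegenerate`.
  sum-unit : ∀ {n} (g : Carrier → Carrier) → g 0# ≡ 0# → g 1# ≡ 1# → ∀ (i : Fin n) (x : Fin n → Carrier) →
             sum (λ j → g (lookup (unit i) j) * x j) ≡ x i
  sum-unit g g0 g1 Fin.zero x = trans
    (cong₂ _+_ (trans (cong (_* x Fin.zero) g1) (*-identityˡ _))
      (sum-zero _ λ j → trans (cong (λ y → g y * x (Fin.suc j)) (Vecₚ.lookup-replicate j 0#))
        (trans (cong (_* x (Fin.suc j)) g0) (zeroˡ _))))
    (+-identityʳ _)
  sum-unit g g0 g1 (Fin.suc i) x = trans
    (cong₂ _+_ (trans (cong (_* x Fin.zero) g0) (zeroˡ _)) (sum-unit g g0 g1 i (x ∘ Fin.suc)))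
    (+-identityˡ _)

  combination-unit : ∀ {n r} (w : Fin r → Vec Carrier n) j → combination w (unit j) ≡ w j
  combination-unit {r = r} w j = lookup-ext λ i →
    trans (lookup-lincomb r (lookup (unit j)) w i) (sum-unit id refl refl j (λ k → lookup (w k) i))

  -- Rank and nullity

  apply : ∀ {n} → Mat n → Vec Carrier n → Vec Carrier n
  apply A = combination (column A)

  nullspace : ∀ {n} → Mat n → List (Vec Carrier n)
  nullspace {n} A = filter (λ v → apply A v ≟ᵛ 𝟎) (vectors n)

  all-subgroup : ∀ n → Subgroups.IsSubgroup (vectorGroup n) (vectors n)
  all-subgroup n = record
    { unique = vectors-unique n
    ; ε-closed = vectors-complete _
    ; ∙-closed = λ _ _ → vectors-complete _
    ; ⁻¹-closed = λ _ → vectors-complete _ }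

  independent-injective : ∀ {n r} {w : Fin r → Vec Carrier n} → LinIndep r w →
                          ∀ {c d} → combination w c ≡ combination w d → c ≡ d
  independent-injective {r = r} {w} indep {c} {d} eq = sym (∙-injective (Vec.map (-_) d)
    (trans (inverseˡ d) (sym (lookup-ext λ i → trans (indep (lookup (Vec.map (-_) d ⊞ c)) vanish i) (sym (Vecₚ.lookup-replicate i 0#))))))
    where
    open Subgroups (vectorGroup r) using (∙-injective)
    open IsAbelianGroup (vectorGroup r) using (inverseˡ)
    vanish : combination w (Vec.map (-_) d ⊞ c) ≡ 𝟎
    vanish = trans (combination-⊞ w (Vec.map (-_) d) c) (trans (cong (combination w (Vec.map (-_) d) ⊞_) eq)
      (trans (sym (combination-⊞ w (Vec.map (-_) d) d)) (trans (cong (combination w) (inverseˡ d)) (combination-𝟎 w))))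

  -- All coefficient vectors are searched, which turns the negated hypothesis into a witness. If the
  -- search fails, a relation between `u` and `w` cannot involve `u`, and `w` admits no nontrivial
  -- relation.
  dependent-span : ∀ {n r} (u : Vec Carrier n) (w : Fin r → Vec Carrier n) → LinIndep r w →
    ¬ LinIndep (suc r) (u Vector.∷ w) → ∃ λ c → combination w c ≡ u
  dependent-span {r = r} u w indep dep with Any.any? (λ c → combination w c ≟ᵛ u) (vectors r)
  ... | yes some = let c , _ , eq = find some in c , eq
  ... | no  none = contradiction independent dep
    where
    outside : ∀ c → combination w c ≢ u
    outside c eq = none (lose (vectors-complete c) eq)

    independent : LinIndep (suc r) (u Vector.∷ w)
    independent c eq = λ { Fin.zero → c₀≡0 ; (Fin.suc i) → indep (c ∘ Fin.suc) rest≡0 i }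
      where
      c₀ : Carrier
      c₀ = c Fin.zero
      rest : Vec Carrier _
      rest = lincomb r (c ∘ Fin.suc) w
      entry≡0 : ∀ i → c₀ * lookup u i + lookup rest i ≡ 0#
      entry≡0 i = trans (sym (lookup-axpy c₀ u rest i)) (trans (cong (λ v → lookup v i) eq) (Vecₚ.lookup-replicate i 0#))
      c₀≡0 : c₀ ≡ 0#
      c₀≡0 with c₀ ≟ 0#
      ... | yes c₀≡0 = c₀≡0
      -- Dividing the relation by `- c₀` expresses `u` through `w`. Adding `𝟎` turns the scaling
      -- into an `axpy`, which `combination-axpy` can handle.
      ... | no  c₀≢0 = contradiction solved (outside (- b · tabulate (c ∘ Fin.suc) ⊞ 𝟎))
        where
        b : Carrier
        b = proj₁ (inverse c₀ c₀≢0)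
        open ≡-Reasoning
        solved : combination w (axpy (- b) (tabulate (c ∘ Fin.suc)) 𝟎) ≡ u
        solved = lookup-ext λ i → *-cancelˡ c₀≢0 (begin
          c₀ * lookup (combination w (axpy (- b) (tabulate (c ∘ Fin.suc)) 𝟎)) i
            ≡⟨ cong (λ v → c₀ * lookup v i) (trans (combination-axpy w (- b) (tabulate (c ∘ Fin.suc)) 𝟎)
                 (cong₂ (axpy (- b)) (lincomb-cong r (Vecₚ.lookup∘tabulate (c ∘ Fin.suc)) λ _ → refl) (combination-𝟎 w))) ⟩
          c₀ * lookup (axpy (- b) rest 𝟎) i
            ≡⟨ cong (c₀ *_) (trans (lookup-axpy (- b) rest 𝟎 i) (trans (cong (- b * lookup rest i +_) (Vecₚ.lookup-replicate i 0#)) (+-identityʳ _))) ⟩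
          c₀ * (- b * lookup rest i)     ≡⟨ cong (c₀ *_) (-‿distribˡ-* b (lookup rest i)) ⟨
          c₀ * (- (b * lookup rest i))   ≡⟨ -‿distribʳ-* c₀ _ ⟨
          - (c₀ * (b * lookup rest i))   ≡⟨ cong -_ (trans (sym (*-assoc c₀ b _)) (trans (cong (_* lookup rest i) (proj₂ (inverse c₀ c₀≢0))) (*-identityˡ _))) ⟩
          - lookup rest i                ≡⟨ ⊞.∙-injective (lookup rest i) (trans (-‿inverseʳ _) (trans (sym (entry≡0 i)) (+-comm _ _))) ⟩
          c₀ * lookup u i                ∎)
      rest≡0 : rest ≡ 𝟎
      rest≡0 = lookup-ext λ i → trans (sym (+-identityˡ _)) (trans (cong (_+ lookup rest i)
        (trans (sym (zeroˡ (lookup u i))) (cong (_* lookup u i) (sym c₀≡0)))) (trans (entry≡0 i) (sym (Vecₚ.lookup-replicate i 0#))))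

  -- The image of `apply A` is the span of `r` independent columns and so has q^(2r) elements;
  -- `image-kernel` does the rest.
  rank-nullity : ∀ {n} (A : Mat n) r → HasRank A r →
                 (q ℕ.* q) ℕ.^ n ≡ (q ℕ.* q) ℕ.^ r ℕ.* length (nullspace A)
  rank-nullity {n} A r ((f , indep) , maximal) = begin
    (q ℕ.* q) ℕ.^ n                                        ≡⟨ length-vectors n ⟨
    length (vectors n)                                     ≡⟨ image-kernel (all-subgroup n) ⟩
    length (image (vectors n)) ℕ.* length (nullspace A)    ≡⟨ cong (ℕ._* length (nullspace A)) image-length ⟩
    (q ℕ.* q) ℕ.^ r ℕ.* length (nullspace A)               ∎
    where
    open ≡-Reasoning
    open Homomorphisms (vectorGroup n) (vectorGroup n) _≟ᵛ_ (apply A) (combination-⊞ (column A))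

    basis : Fin r → Vec Carrier n
    basis = column A ∘ f

    extend : Fin n → Fin (suc r) → Fin n
    extend j Fin.zero    = j
    extend j (Fin.suc i) = f i

    column-span : ∀ j → ∃ λ c → combination basis c ≡ column A j
    column-span j = dependent-span (column A j) basis indep λ indep′ →
      -- Maximality concerns families of columns chosen by indices; `extend j` adds column `j` to
      -- the basis, and `lincomb-cong` passes between the two pointwise equal families.
      maximal (extend j) λ c eq → indep′ c (trans (lincomb-cong (suc r) {c} {c} {column A j Vector.∷ basis} {column A ∘ extend j} (λ _ → refl) (λ { Fin.zero → refl ; (Fin.suc i) → refl })) eq)

    image-length : length (image (vectors n)) ≡ (q ℕ.* q) ℕ.^ r
    image-length = trans
      (≅-length (image-unique (vectors n)) (Uniqueₚ.map⁺ (independent-injective indep) (vectors-unique r)) (to , from))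
      (trans (Listₚ.length-map (combination basis) (vectors r)) (length-vectors r))
      where
      to : ∀ {v} → v ∈ image (vectors n) → v ∈ List.map (combination basis) (vectors r)
      to v∈ with ∈-image⁻ (vectors n) v∈
      ... | u , _ , refl = subst (_∈ _)
        (trans (combination-lincomb basis n (lookup u) (proj₁ ∘ column-span)) (lincomb-cong n (λ _ → refl) (proj₂ ∘ column-span)))
        (∈-map⁺ (combination basis) (vectors-complete (lincomb n (lookup u) (proj₁ ∘ column-span))))
      -- Each basis column is the image of a unit vector.
      from : ∀ {v} → v ∈ List.map (combination basis) (vectors r) → v ∈ image (vectors n)
      from v∈ with ∈-map⁻ (combination basis) v∈
      ... | c , _ , refl = subst (_∈ _)
        (trans (combination-lincomb (column A) r (lookup c) (unit ∘ f)) (lincomb-cong r (λ _ → refl) (combination-unit (column A) ∘ f)))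
        (∈-image⁺ (vectors-complete (lincomb r (lookup c) (unit ∘ f))))

  -- The sesquilinear form u* A v of a matrix

  form : ∀ {n} → Mat n → Vec Carrier n → Vec Carrier n → Carrier
  form A u v = sum (λ i → conj (lookup u i) * lookup (apply A v) i)

  form-axpy : ∀ {n} (A : Mat n) w c u v → form A w (axpy c u v) ≡ c * form A w u + form A w v
  form-axpy A w c u v = begin
    sum (λ i → conj (lookup w i) * lookup (apply A (axpy c u v)) i)
      ≡⟨ sum-cong-≗ (λ i → trans (cong (conj (lookup w i) *_)
           (trans (cong (λ x → lookup x i) (combination-axpy (column A) c u v)) (lookup-axpy c (apply A u) (apply A v) i)))
           (expand (conj (lookup w i)) (lookup (apply A u) i) (lookup (apply A v) i))) ⟩
    sum (λ i → c * (conj (lookup w i) * lookup (apply A u) i) + conj (lookup w i) * lookup (apply A v) i)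
      ≡⟨ ∑-distrib-+ (λ i → c * (conj (lookup w i) * lookup (apply A u) i)) (λ i → conj (lookup w i) * lookup (apply A v) i) ⟩
    sum (λ i → c * (conj (lookup w i) * lookup (apply A u) i)) + form A w v
      ≡⟨ cong (_+ form A w v) (*-distribˡ-sum c (λ i → conj (lookup w i) * lookup (apply A u) i)) ⟨
    c * form A w u + form A w v ∎
    where
    open ≡-Reasoning
    expand : ∀ x y z → x * (c * y + z) ≡ c * (x * y) + x * z
    expand x y z = trans (distribˡ x (c * y) z) (cong (_+ x * z)
      (trans (sym (*-assoc x c y)) (trans (cong (_* y) (*-comm x c)) (*-assoc c x y))))

  lookup-apply : ∀ {n} (A : Mat n) v i → lookup (apply A v) i ≡ sum (λ j → lookup v j * entry A i j)
  lookup-apply {n} A v i = trans (lookup-lincomb n (lookup v) (column A) i)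
    (sum-cong-≗ λ j → cong (lookup v j *_) (Vecₚ.lookup-map i (λ row → lookup row j) A))

  form-∑ : ∀ {n} (A : Mat n) u v → form A u v ≡ sum (λ i → sum (λ j → conj (lookup u i) * (lookup v j * entry A i j)))
  form-∑ A u v = sum-cong-≗ λ i → trans (cong (conj (lookup u i) *_) (lookup-apply A v i))
    (*-distribˡ-sum (conj (lookup u i)) (λ j → lookup v j * entry A i j))

  conj-sum : ∀ {n} (f : Fin n → Carrier) → conj (sum f) ≡ sum (conj ∘ f)
  conj-sum {zero}  f = conj-0
  conj-sum {suc n} f = trans (conj-+ (f Fin.zero) (sum (f ∘ Fin.suc))) (cong (conj (f Fin.zero) +_) (conj-sum (f ∘ Fin.suc)))

  -- In the double sum the two indices are exchanged, and hermitian symmetry matches the terms one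
  -- by one.
  form-sym : ∀ {n} {A : Mat n} → IsHermitian A → ∀ u v → form A v u ≡ conj (form A u v)
  form-sym {n} {A} herm u v = begin
    form A v u
      ≡⟨ form-∑ A v u ⟩
    sum (λ i → sum (λ j → conj (lookup v i) * (lookup u j * entry A i j)))
      ≡⟨ ∑-comm (λ i j → conj (lookup v i) * (lookup u j * entry A i j)) ⟩
    sum (λ j → sum (λ i → conj (lookup v i) * (lookup u j * entry A i j)))
      ≡⟨ sum-cong-≗ (λ j → sum-cong-≗ (λ i → term i j)) ⟩
    sum (λ j → sum (λ i → conj (conj (lookup u j) * (lookup v i * entry A j i))))
      ≡⟨ sum-cong-≗ (λ j → conj-sum (λ i → conj (lookup u j) * (lookup v i * entry A j i))) ⟨
    sum (λ j → conj (sum (λ i → conj (lookup u j) * (lookup v i * entry A j i))))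
      ≡⟨ conj-sum (λ j → sum (λ i → conj (lookup u j) * (lookup v i * entry A j i))) ⟨
    conj (sum (λ j → sum (λ i → conj (lookup u j) * (lookup v i * entry A j i))))
      ≡⟨ cong conj (form-∑ A u v) ⟨
    conj (form A u v) ∎
    where
    open ≡-Reasoning
    term : ∀ i j → conj (lookup v i) * (lookup u j * entry A i j) ≡ conj (conj (lookup u j) * (lookup v i * entry A j i))
    term i j = begin
      conj (lookup v i) * (lookup u j * entry A i j)
        ≡⟨ cong₂ (λ x y → conj (lookup v i) * (x * y)) (sym (conj-involutive (lookup u j))) (herm j i) ⟩
      conj (lookup v i) * (conj (conj (lookup u j)) * conj (entry A j i))
        ≡⟨ solve 3 (λ x y z → x ⊗ (y ⊗ z) ⊜ y ⊗ (x ⊗ z)) refl (conj (lookup v i)) (conj (conj (lookup u j))) (conj (entry A j i)) ⟩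
      conj (conj (lookup u j)) * (conj (lookup v i) * conj (entry A j i))
        ≡⟨ cong (conj (conj (lookup u j)) *_) (conj-* (lookup v i) (entry A j i)) ⟨
      conj (conj (lookup u j)) * conj (lookup v i * entry A j i)
        ≡⟨ conj-* (conj (lookup u j)) (lookup v i * entry A j i) ⟨
      conj (conj (lookup u j) * (lookup v i * entry A j i)) ∎
      where open RingSolver

  form-⊕ : ∀ {n} (A B : Mat n) u v → form (A ⊕ B) u v ≡ form A u v + form B u v
  form-⊕ A B u v = trans
    (sum-cong-≗ λ i → trans (cong (conj (lookup u i) *_) (apply-⊕ i)) (distribˡ _ _ _))
    (∑-distrib-+ (λ i → conj (lookup u i) * lookup (apply A v) i) (λ i → conj (lookup u i) * lookup (apply B v) i))
    where
    open ≡-Reasoning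
    entry-⊕ : ∀ i j → entry (A ⊕ B) i j ≡ entry A i j + entry B i j
    entry-⊕ i j = trans (cong (λ row → lookup row j) (Vecₚ.lookup-zipWith _⊞_ i A B))
                        (Vecₚ.lookup-zipWith _+_ j (lookup A i) (lookup B i))
    apply-⊕ : ∀ i → lookup (apply (A ⊕ B) v) i ≡ lookup (apply A v) i + lookup (apply B v) i
    apply-⊕ i = begin
      lookup (apply (A ⊕ B) v) i
        ≡⟨ lookup-apply (A ⊕ B) v i ⟩
      sum (λ j → lookup v j * entry (A ⊕ B) i j)
        ≡⟨ sum-cong-≗ (λ j → trans (cong (lookup v j *_) (entry-⊕ i j)) (distribˡ _ _ _)) ⟩
      sum (λ j → lookup v j * entry A i j + lookup v j * entry B i j)
        ≡⟨ ∑-distrib-+ (λ j → lookup v j * entry A i j) (λ j → lookup v j * entry B i j) ⟩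
      sum (λ j → lookup v j * entry A i j) + sum (λ j → lookup v j * entry B i j)
        ≡⟨ cong₂ _+_ (lookup-apply A v i) (lookup-apply B v i) ⟨
      lookup (apply A v) i + lookup (apply B v) i ∎

  form-𝟎 : ∀ {n} (A : Mat n) u → form A u 𝟎 ≡ 0#
  form-𝟎 A u = sum-zero _ λ i → trans (cong (λ v → conj (lookup u i) * lookup v i) (combination-𝟎 (column A)))
    (trans (cong (conj (lookup u i) *_) (Vecₚ.lookup-replicate i 0#)) (zeroʳ _))

  -- Pairing with the unit vectors reads off the entries of `A v`. This makes the nullspace the
  -- radical of the form.
  form-nondegenerate : ∀ {n} (A : Mat n) v → (∀ u → form A u v ≡ 0#) → apply A v ≡ 𝟎
  form-nondegenerate A v orth = lookup-ext λ i → trans (sym (sum-unit conj conj-0 conj-1 i (lookup (apply A v))))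
    (trans (orth (unit i)) (sym (Vecₚ.lookup-replicate i 0#)))

  isotropicVectors : ∀ {n} → Mat n → List (Vec Carrier n)
  isotropicVectors {n} A = filter (λ v → form A v v ≟ 0#) (vectors n)

  -- `isotropic-count` applies with the nullspace as radical and some number `k` of steps. Its size
  -- formula and `rank-nullity` both express q^(2n) through the size of the nullspace, which forces
  -- `k` to be the rank.
  length-isotropicVectors : ∀ {n} {A : Mat n} {r} → IsHermitian A → HasRank A r →
    Alternating r (q ℕ.* length (isotropicVectors A)) ((q ℕ.* q) ℕ.^ n) (q ℕ.^ r ℕ.* (pred q ℕ.* length (nullspace A)))
  length-isotropicVectors {n} {A} {r} herm rank = go (isotropic-count nullspace-unique all-subspace radical)
    where
    open Forms q-primePower F
    open HermitianForm axpy axpy-inverse (form A) (form-axpy A) (form-sym herm)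
    nullspace-unique : Unique (nullspace A)
    nullspace-unique = Uniqueₚ.filter⁺ _ (vectors-unique n)
    all-subspace : IsSubspace (vectors n)
    all-subspace = record { unique = vectors-unique n ; closed = λ _ _ _ → vectors-complete _ }
    radical : IsRadical (nullspace A) (vectors n)
    radical {w} = to , λ w∈ orth → ∈-filter⁺ _ w∈ (form-nondegenerate A w λ u → orth (vectors-complete u))
      where
      to : w ∈ nullspace A → w ∈ vectors n × (∀ {u} → u ∈ vectors n → form A u w ≡ 0#)
      to w∈ = vectors-complete w , λ {u} _ → sum-zero _ λ i →
        trans (cong (λ v → conj (lookup u i) * lookup v i) (proj₂ (∈-filter⁻ _ {xs = vectors n} w∈)))
          (trans (cong (conj (lookup u i) *_) (Vecₚ.lookup-replicate i 0#)) (zeroʳ _))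
    Q>1 : 1 < q ℕ.* q
    Q>1 = ℕₚ.<-trans 2≤q q<q*q
    go : (∃ λ k → IsotropicCount k (nullspace A) (vectors n)) → Alternating r _ _ _
    go (k , order , alternating) with ^-injective Q>1 {k} {r} same
      where
      instance
        null≢0 : ℕ.NonZero (length (nullspace A))
        null≢0 = ℕ.≢-nonZero λ eq → ℕₚ.n≮0 {0} (subst (0 <_)
          (trans (rank-nullity A r rank) (trans (cong ((q ℕ.* q) ℕ.^ r ℕ.*_) eq) (ℕₚ.*-zeroʳ ((q ℕ.* q) ℕ.^ r))))
          (ℕₚ.m^n>0 (q ℕ.* q) {{ℕ.>-nonZero (ℕₚ.<-trans (s≤s z≤n) Q>1)}} n))
      same : (q ℕ.* q) ℕ.^ k ≡ (q ℕ.* q) ℕ.^ r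
      same = ℕₚ.*-cancelʳ-≡ _ _ (length (nullspace A))
        (trans (sym order) (trans (length-vectors n) (rank-nullity A r rank)))
    ... | refl = subst (λ l → Alternating r (q ℕ.* length (isotropicVectors A)) l (q ℕ.^ r ℕ.* (pred q ℕ.* length (nullspace A)))) (length-vectors n) alternating

-- Linear constant rank-distance sets

^-square : ∀ b n → (b ℕ.* b) ℕ.^ n ≡ b ℕ.^ n ℕ.* b ℕ.^ n
^-square b n = begin
  (b ℕ.* b) ℕ.^ n        ≡⟨ cong (λ c → (b ℕ.* c) ℕ.^ n) (ℕₚ.*-identityʳ b) ⟨
  (b ℕ.^ 2) ℕ.^ n        ≡⟨ ℕₚ.^-*-assoc b 2 n ⟩
  b ℕ.^ (n ℕ.+ (n ℕ.+ 0)) ≡⟨ cong (λ e → b ℕ.^ (n ℕ.+ e)) (ℕₚ.+-identityʳ n) ⟩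
  b ℕ.^ (n ℕ.+ n)        ≡⟨ ℕₚ.^-distribˡ-+-* b n n ⟩
  b ℕ.^ n ℕ.* b ℕ.^ n    ∎
  where open ≡-Reasoning

coprime-power : ∀ {b x} → Coprime b x → ∀ k → Coprime (b ℕ.^ k) x
coprime-power b⊥x zero    (d∣1 , _) = Div.∣1⇒≡1 d∣1
coprime-power b⊥x (suc k) {d} (d∣b^k , d∣x) = coprime-power b⊥x k
  (coprime-divisor (λ (e∣d , e∣b) → b⊥x (e∣b , ∣-trans e∣d d∣x)) d∣b^k , d∣x)

-- A common divisor divides b^k as well as b^k - 1, hence 1.
coprime-pred-power : ∀ b {k} → .{{ℕ.NonZero b}} → 1 ≤ k → Coprime b (pred (b ℕ.^ k))
coprime-pred-power b {suc k} _ {d} (d∣b , d∣) = Div.∣1⇒≡1 (Div.∣m+n∣m⇒∣n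
  (subst (d ∣_) (trans (sym (ℕₚ.suc-pred (b ℕ.^ suc k) {{ℕₚ.m^n≢0 b (suc k)}})) (ℕₚ.+-comm 1 _)) (Div.∣m⇒∣m*n (b ℕ.^ k) d∣b)) d∣)

module LinearConstantRank {q : ℕ} (q-primePower : IsPrimePower q) (F : FiniteField (q ℕ.* q)) where

  open FiniteField F using (Carrier; 0#; 1#; elements) renaming (_+_ to _+ᶠ_; _*_ to _*ᶠ_; -_ to -ᶠ_)
  open FieldProperties F
  open Conjugation q-primePower F
  open Hermitian q F
  open Matrices q-primePower F

  instance
    q≢0 : ℕ.NonZero q
    q≢0 = ℕ.>-nonZero (ℕₚ.<-trans (s≤s z≤n) 2≤q)

  1⊛ : ∀ {n} (A : Mat n) → 1# ⊛ A ≡ A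
  1⊛ A = trans (Vecₚ.map-cong 1·v≡v A) (Vecₚ.map-id A)

  0⊛ : ∀ {n} (A : Mat n) → 0# ⊛ A ≡ zeroMat
  0⊛ A = trans (Vecₚ.map-cong (λ v → trans (Vecₚ.map-cong zeroˡ v) (Vecₚ.map-const v 0#)) A) (Vecₚ.map-const A 𝟎)

  fixed-subgroup : ⊞.IsSubgroup fixed
  fixed-subgroup = record
    { unique = fixed-unique
    ; ε-closed = ∈-fixed⁺ conj-0
    ; ∙-closed = λ {x} {y} x∈ y∈ → ∈-fixed⁺ (trans (conj-+ x y) (cong₂ _+ᶠ_ (∈-fixed⁻ x∈) (∈-fixed⁻ y∈)))
    ; ⁻¹-closed = λ {x} x∈ → ∈-fixed⁺ (trans (conj-neg x) (cong -ᶠ_ (∈-fixed⁻ x∈)))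
    }

  module MatrixSubgroups (n : ℕ) = Subgroups (matrixGroup n)

  -- The scalars 0, 1 and -1 lie in every subfield, so 0 A + 0 A, 1 A + 1 B and (-1) A + 0 A lie in
  -- `U`. The given member is what produces the zero matrix.
  linear-subgroup : ∀ {n} {U : List (Mat n)} {A} → A ∈ U → Unique U → IsLinear U → MatrixSubgroups.IsSubgroup n U
  linear-subgroup {n} {U} {A₀} A₀∈ U! (S , isSubfield , closed) = record
    { unique = U!
    ; ε-closed = subst (_∈ U) (trans (cong₂ _⊕_ (0⊛ A₀) (0⊛ A₀)) (identityˡ zeroMat)) (closed A₀∈ A₀∈ has-0 has-0)
    ; ∙-closed = λ {A} {B} A∈ B∈ → subst (_∈ U) (cong₂ _⊕_ (1⊛ A) (1⊛ B)) (closed A∈ B∈ has-1 has-1)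
    ; ⁻¹-closed = λ {A} A∈ → subst (_∈ U)
        (trans (cong₂ _⊕_ (Vecₚ.map-cong (Vecₚ.map-cong -1*x≈-x) A) (0⊛ A)) (identityʳ (Vec.map (Vec.map -ᶠ_) A)))
        (closed A∈ A∈ (neg-closed has-1) has-0)
    }
    where
    open IsSubfieldOfFq isSubfield
    open IsAbelianGroup (matrixGroup n) using (identityˡ; identityʳ)

  matrices : ∀ n → List (Mat n)
  matrices n = allVecs (vectors n) n

  -- Lagrange's theorem in the group of all matrices, of order q^(2 n^2). The purpose is to confine
  -- the prime divisors of the order to those of q.
  subgroup-order : ∀ {n} {U : List (Mat n)} → MatrixSubgroups.IsSubgroup n U → ∃ λ e → length U ∣ q ℕ.^ e
  subgroup-order {n} {U} U≤ = (n ℕ.+ n) ℕ.* n , subst (length U ∣_) order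
    (MatrixSubgroups.lagrange n (Vecₚ.≡-dec _≟ᵛ_) U≤ all (λ _ → complete _))
    where
    complete : (A : Mat n) → A ∈ matrices n
    complete = allVecs-complete vectors-complete
    all : MatrixSubgroups.IsSubgroup n (matrices n)
    all = record
      { unique = allVecs-unique (vectors-unique n) n
      ; ε-closed = complete _ ; ∙-closed = λ _ _ → complete _ ; ⁻¹-closed = λ _ → complete _ }
    open ≡-Reasoning
    order : length (matrices n) ≡ q ℕ.^ ((n ℕ.+ n) ℕ.* n)
    order = begin
      length (matrices n)             ≡⟨ length-allVecs (vectors n) n ⟩
      length (vectors n) ℕ.^ n        ≡⟨ cong (ℕ._^ n) (length-vectors n) ⟩
      ((q ℕ.* q) ℕ.^ n) ℕ.^ n         ≡⟨ cong (ℕ._^ n) (trans (^-square q n) (sym (ℕₚ.^-distribˡ-+-* q n n))) ⟩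
      (q ℕ.^ (n ℕ.+ n)) ℕ.^ n         ≡⟨ ℕₚ.^-*-assoc q (n ℕ.+ n) n ⟩
      q ℕ.^ ((n ℕ.+ n) ℕ.* n)         ∎

  -- Counting pairs of a matrix in U and a vector isotropic for it

  module _ {n : ℕ} {U : List (Mat n)} (U≤ : MatrixSubgroups.IsSubgroup n U)
           (herm : ∀ {A} → A ∈ U → IsHermitian A) where

    private
      N : ℕ
      N = length U

    module Evaluation (v : Vec Carrier n) = Homomorphisms (matrixGroup n) +-isAbelianGroup _≟_ (λ A → form A v v) (λ A B → form-⊕ A B v v)

    annihilator : Vec Carrier n → List (Mat n)
    annihilator v = filter (λ A → form A v v ≟ 0#) U

    -- The values `form A v v` are fixed by conjugation, so they form a subgroup of F_q, of order
    -- dividing q; and N is this order times the size of the kernel.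
    order-∣ : ∀ v → N ∣ q ℕ.* length (annihilator v)
    order-∣ v with subst (length (image U) ∣_) length-fixed
                     (⊞.lagrange _≟_ (image-subgroup U≤) fixed-subgroup into)
      where
      open Evaluation v
      into : ∀ {x} → x ∈ image U → x ∈ fixed
      into x∈ with ∈-image⁻ U x∈
      ... | A , A∈ , refl = ∈-fixed⁺ (sym (form-sym (herm A∈) v v))
    ... | divides c q≡c*im = divides c (begin
      q ℕ.* length (annihilator v)                      ≡⟨ cong (ℕ._* length (annihilator v)) q≡c*im ⟩
      c ℕ.* length (image U) ℕ.* length (annihilator v) ≡⟨ ℕₚ.*-assoc c _ _ ⟩
      c ℕ.* (length (image U) ℕ.* length (annihilator v)) ≡⟨ cong (c ℕ.*_) (image-kernel U≤) ⟨
      c ℕ.* N                                           ∎)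
      where
      open Evaluation v
      open ≡-Reasoning

    isotropicTotal : ℕ
    isotropicTotal = ∑ U (λ A → q ℕ.* length (isotropicVectors A))

    double-count : isotropicTotal ≡ ∑ (vectors n) (λ v → q ℕ.* length (annihilator v))
    double-count = begin
      ∑ U (λ A → q ℕ.* length (isotropicVectors A))
        ≡⟨ ∑-cong U (λ {A} _ → cong (q ℕ.*_) (length-filter-∑ (λ v → form A v v ≟ 0#) (vectors n))) ⟩
      ∑ U (λ A → q ℕ.* ∑ (vectors n) (λ v → [ form A v v ≟ 0# ]))
        ≡⟨ ∑-* U q _ ⟩
      q ℕ.* ∑ U (λ A → ∑ (vectors n) (λ v → [ form A v v ≟ 0# ]))
        ≡⟨ cong (q ℕ.*_) (∑-swap U (vectors n) (λ A v → [ form A v v ≟ 0# ])) ⟩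
      q ℕ.* ∑ (vectors n) (λ v → ∑ U (λ A → [ form A v v ≟ 0# ]))
        ≡⟨ ∑-* (vectors n) q _ ⟨
      ∑ (vectors n) (λ v → q ℕ.* ∑ U (λ A → [ form A v v ≟ 0# ]))
        ≡⟨ ∑-cong (vectors n) (λ {v} _ → cong (q ℕ.*_) (length-filter-∑ (λ A → form A v v ≟ 0#) U)) ⟨
      ∑ (vectors n) (λ v → q ℕ.* length (annihilator v)) ∎
      where open ≡-Reasoning

    zero∈ : zeroMat ∈ U
    zero∈ = MatrixSubgroups.IsSubgroup.ε-closed U≤

    N>0 : 0 < N
    N>0 = ∈-length zero∈

    form-zero : ∀ v → form (zeroMat {n}) v v ≡ 0#
    form-zero v = Evaluation.φ-ε v

    -- The zero matrix lies in every annihilator, so the multiple of N in `order-∣` is not 0.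
    order-≤ : ∀ v → N ≤ q ℕ.* length (annihilator v)
    order-≤ v = Div.∣⇒≤ {{ℕₚ.m*n≢0 q _ {{q≢0}} {{ℕ.>-nonZero (∈-length (∈-filter⁺ _ zero∈ (form-zero v)))}}}} (order-∣ v)

    order-∣-total : N ∣ isotropicTotal
    order-∣-total = subst (N ∣_) (sym double-count) (∑-∣ (vectors n) λ {v} _ → order-∣ v)

    -- the zero vector contributes q N > N
    total-> : N ℕ.* (q ℕ.* q) ℕ.^ n < isotropicTotal
    total-> = begin-strict
      N ℕ.* (q ℕ.* q) ℕ.^ n                       ≡⟨ ℕₚ.*-comm N _ ⟩
      (q ℕ.* q) ℕ.^ n ℕ.* N                       ≡⟨ cong (ℕ._* N) (length-vectors n) ⟨
      length (vectors n) ℕ.* N                    ≡⟨ ∑-const (vectors n) N ⟨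
      ∑ (vectors n) (λ _ → N)                     <⟨ ℕₚ.n<1+n _ ⟩
      suc (∑ (vectors n) (λ _ → N))               ≡⟨ ℕₚ.+-comm 1 _ ⟩
      ∑ (vectors n) (λ _ → N) ℕ.+ 1               ≡⟨ cong (∑ (vectors n) (λ _ → N) ℕ.+_)
                                                       (Finite.count-one _≟ᵛ_ (vectors-unique n) (vectors-complete 𝟎)) ⟨
      ∑ (vectors n) (λ _ → N) ℕ.+ ∑ (vectors n) (λ v → [ 𝟎 ≟ᵛ v ]) ≡⟨ ∑-+ (vectors n) _ _ ⟨
      ∑ (vectors n) (λ v → N ℕ.+ [ 𝟎 ≟ᵛ v ])      ≤⟨ ∑-mono (vectors n) (λ {v} _ → pointwise v) ⟩
      ∑ (vectors n) (λ v → q ℕ.* length (annihilator v)) ≡⟨ double-count ⟨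
      isotropicTotal                              ∎
      where
      open ℕₚ.≤-Reasoning
      pointwise : ∀ v → N ℕ.+ [ 𝟎 ≟ᵛ v ] ≤ q ℕ.* length (annihilator v)
      pointwise v with 𝟎 ≟ᵛ v
      ... | no _ = subst (ℕ._≤ q ℕ.* length (annihilator v)) (sym (ℕₚ.+-identityʳ N)) (order-≤ v)
      ... | yes refl = begin
        N ℕ.+ 1                            ≤⟨ ℕₚ.+-monoʳ-≤ N N>0 ⟩
        N ℕ.+ N                            ≡⟨ cong (N ℕ.+_) (ℕₚ.+-identityʳ N) ⟨
        2 ℕ.* N                            ≤⟨ ℕₚ.*-monoˡ-≤ N 2≤q ⟩
        q ℕ.* N                            ≡⟨ cong (λ V → q ℕ.* length V) (Listₚ.filter-all (λ A → form A 𝟎 𝟎 ≟ 0#) {xs = U} (All.tabulate (λ {A} _ → form-𝟎 A 𝟎))) ⟨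
        q ℕ.* length (annihilator 𝟎)       ∎

    -- The bounds for odd and for even rank

    module _ {k : ℕ} (1≤k : 1 ≤ k) (k≤n : k ≤ n) (rank : ∀ {A} → A ∈ U → A ≢ zeroMat → HasRank A k) where

      private
        m P Y : ℕ
        m = pred q
        P = q ℕ.^ (2 ℕ.* n ℕ.∸ k)
        Y = (q ℕ.* q) ℕ.^ n

        -- The indicator of the zero matrix. It lets the exceptional count at zero and the common
        -- count elsewhere be summed as one affine expression.
        δ : Mat n → ℕ
        δ A = [ Vecₚ.≡-dec _≟ᵛ_ zeroMat A ]

        instance
          q^k≢0 : ℕ.NonZero (q ℕ.^ k)
          q^k≢0 = ℕₚ.m^n≢0 q k
          P≢0 : ℕ.NonZero P
          P≢0 = ℕₚ.m^n≢0 q (2 ℕ.* n ℕ.∸ k)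
          m≢0 : ℕ.NonZero m
          m≢0 = ℕ.>-nonZero (ℕₚ.≤-pred (subst (2 ≤_) (sym (ℕₚ.suc-pred q)) 2≤q))

      Y≡q^k*P : Y ≡ q ℕ.^ k ℕ.* P
      Y≡q^k*P = begin
        (q ℕ.* q) ℕ.^ n                  ≡⟨ ^-square q n ⟩
        q ℕ.^ n ℕ.* q ℕ.^ n              ≡⟨ ℕₚ.^-distribˡ-+-* q n n ⟨
        q ℕ.^ (n ℕ.+ n)                  ≡⟨ cong (λ e → q ℕ.^ (n ℕ.+ e)) (ℕₚ.+-identityʳ n) ⟨
        q ℕ.^ (2 ℕ.* n)                  ≡⟨ cong (q ℕ.^_) (ℕₚ.m+[n∸m]≡n (ℕₚ.≤-trans k≤n (ℕₚ.m≤m+n n _))) ⟨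
        q ℕ.^ (k ℕ.+ (2 ℕ.* n ℕ.∸ k))    ≡⟨ ℕₚ.^-distribˡ-+-* q k _ ⟩
        q ℕ.^ k ℕ.* P                    ∎
        where open ≡-Reasoning

      isotropic-rank : ∀ {A} → A ∈ U → A ≢ zeroMat → Alternating k (q ℕ.* length (isotropicVectors A)) Y (m ℕ.* P)
      isotropic-rank {A} A∈ A≢0 = subst (Alternating k _ Y) eq (length-isotropicVectors (herm A∈) (rank A∈ A≢0))
        where
        open ≡-Reasoning
        Z : ℕ
        Z = length (nullspace A)
        -- The nullspace has q^(2(n-k)) elements; to stay with natural exponents this is used only
        -- after multiplication by q^k.
        q^k*Z≡P : q ℕ.^ k ℕ.* Z ≡ P
        q^k*Z≡P = ℕₚ.*-cancelˡ-≡ _ _ (q ℕ.^ k) (begin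
          q ℕ.^ k ℕ.* (q ℕ.^ k ℕ.* Z)    ≡⟨ ℕₚ.*-assoc (q ℕ.^ k) (q ℕ.^ k) Z ⟨
          q ℕ.^ k ℕ.* q ℕ.^ k ℕ.* Z      ≡⟨ cong (ℕ._* Z) (^-square q k) ⟨
          (q ℕ.* q) ℕ.^ k ℕ.* Z          ≡⟨ rank-nullity A k (rank A∈ A≢0) ⟨
          Y                              ≡⟨ Y≡q^k*P ⟩
          q ℕ.^ k ℕ.* P                  ∎)
        eq : q ℕ.^ k ℕ.* (m ℕ.* Z) ≡ m ℕ.* P
        eq = begin
          q ℕ.^ k ℕ.* (m ℕ.* Z)          ≡⟨ ℕₚ.*-assoc (q ℕ.^ k) m Z ⟨
          q ℕ.^ k ℕ.* m ℕ.* Z            ≡⟨ cong (ℕ._* Z) (ℕₚ.*-comm (q ℕ.^ k) m) ⟩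
          m ℕ.* q ℕ.^ k ℕ.* Z            ≡⟨ ℕₚ.*-assoc m (q ℕ.^ k) Z ⟩
          m ℕ.* (q ℕ.^ k ℕ.* Z)          ≡⟨ cong (m ℕ.*_) q^k*Z≡P ⟩
          m ℕ.* P                        ∎

      isotropic-zero : q ℕ.* length (isotropicVectors (zeroMat {n})) ≡ Y ℕ.+ m ℕ.* Y
      isotropic-zero = begin
        q ℕ.* length (isotropicVectors (zeroMat {n}))
          ≡⟨ cong (λ V → q ℕ.* length V) (Listₚ.filter-all (λ v → form (zeroMat {n}) v v ≟ 0#) {xs = vectors n} (All.tabulate (λ {v} _ → form-zero v))) ⟩
        q ℕ.* length (vectors n)         ≡⟨ cong (q ℕ.*_) (length-vectors n) ⟩
        q ℕ.* Y                          ≡⟨ cong (ℕ._* Y) (ℕₚ.suc-pred q) ⟨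
        Y ℕ.+ m ℕ.* Y                    ∎
        where open ≡-Reasoning

      ∑-δ : ∀ c → ∑ U (λ A → c ℕ.* δ A) ≡ c
      ∑-δ c = trans (∑-* U c δ) (trans (cong (c ℕ.*_) (Finite.count-one (Vecₚ.≡-dec _≟ᵛ_) (MatrixSubgroups.IsSubgroup.unique U≤) zero∈)) (ℕₚ.*-identityʳ c))

      ∑-affine : ∀ c d → ∑ U (λ A → c ℕ.+ d ℕ.* δ A) ≡ N ℕ.* c ℕ.+ d
      ∑-affine c d = trans (∑-+ U (λ _ → c) (λ A → d ℕ.* δ A)) (cong₂ ℕ._+_ (∑-const U c) (∑-δ d))

      -- The N - 1 nonzero matrices contribute `Y + m P` each and the zero matrix contributes
      -- `Y + m Y`; the summand `m P` on the left avoids N - 1.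
      even-total : k % 2 ≡ 0 → isotropicTotal ℕ.+ m ℕ.* P ≡ N ℕ.* (Y ℕ.+ m ℕ.* P) ℕ.+ m ℕ.* Y
      even-total even = begin
        isotropicTotal ℕ.+ m ℕ.* P
          ≡⟨ cong (isotropicTotal ℕ.+_) (∑-δ (m ℕ.* P)) ⟨
        isotropicTotal ℕ.+ ∑ U (λ A → m ℕ.* P ℕ.* δ A)
          ≡⟨ ∑-+ U _ _ ⟨
        ∑ U (λ A → q ℕ.* length (isotropicVectors A) ℕ.+ m ℕ.* P ℕ.* δ A)
          ≡⟨ ∑-cong U (λ {A} A∈ → pointwise A A∈) ⟩
        ∑ U (λ A → (Y ℕ.+ m ℕ.* P) ℕ.+ m ℕ.* Y ℕ.* δ A)
          ≡⟨ ∑-affine (Y ℕ.+ m ℕ.* P) (m ℕ.* Y) ⟩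
        N ℕ.* (Y ℕ.+ m ℕ.* P) ℕ.+ m ℕ.* Y ∎
        where
        open ≡-Reasoning
        pointwise : ∀ A → A ∈ U → q ℕ.* length (isotropicVectors A) ℕ.+ m ℕ.* P ℕ.* δ A ≡ (Y ℕ.+ m ℕ.* P) ℕ.+ m ℕ.* Y ℕ.* δ A
        pointwise A A∈ with Vecₚ.≡-dec _≟ᵛ_ zeroMat A
        ... | yes refl = begin
          q ℕ.* length (isotropicVectors A) ℕ.+ m ℕ.* P ℕ.* 1 ≡⟨ cong₂ ℕ._+_ isotropic-zero (ℕₚ.*-identityʳ _) ⟩
          Y ℕ.+ m ℕ.* Y ℕ.+ m ℕ.* P                           ≡⟨ ℕₚ.+-assoc Y _ _ ⟩
          Y ℕ.+ (m ℕ.* Y ℕ.+ m ℕ.* P)                         ≡⟨ cong (Y ℕ.+_) (ℕₚ.+-comm (m ℕ.* Y) _) ⟩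
          Y ℕ.+ (m ℕ.* P ℕ.+ m ℕ.* Y)                         ≡⟨ ℕₚ.+-assoc Y _ _ ⟨
          Y ℕ.+ m ℕ.* P ℕ.+ m ℕ.* Y                           ≡⟨ cong (Y ℕ.+ m ℕ.* P ℕ.+_) (ℕₚ.*-identityʳ _) ⟨
          Y ℕ.+ m ℕ.* P ℕ.+ m ℕ.* Y ℕ.* 1                     ∎
        ... | no 0≢A = cong₂ ℕ._+_ (proj₁ (isotropic-rank A∈ (0≢A ∘ sym)) even)
                         (trans (ℕₚ.*-zeroʳ (m ℕ.* P)) (sym (ℕₚ.*-zeroʳ (m ℕ.* Y))))

      -- A nonzero matrix now contributes `Y - m P`, so `m P` is added once for every matrix of `U`,
      -- the zero matrix included.
      odd-total : k % 2 ≡ 1 → isotropicTotal ℕ.+ N ℕ.* (m ℕ.* P) ≡ N ℕ.* Y ℕ.+ (m ℕ.* Y ℕ.+ m ℕ.* P)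
      odd-total odd = begin
        isotropicTotal ℕ.+ N ℕ.* (m ℕ.* P)
          ≡⟨ cong (isotropicTotal ℕ.+_) (∑-const U (m ℕ.* P)) ⟨
        isotropicTotal ℕ.+ ∑ U (λ _ → m ℕ.* P)
          ≡⟨ ∑-+ U _ _ ⟨
        ∑ U (λ A → q ℕ.* length (isotropicVectors A) ℕ.+ m ℕ.* P)
          ≡⟨ ∑-cong U (λ {A} A∈ → pointwise A A∈) ⟩
        ∑ U (λ A → Y ℕ.+ (m ℕ.* Y ℕ.+ m ℕ.* P) ℕ.* δ A)
          ≡⟨ ∑-affine Y (m ℕ.* Y ℕ.+ m ℕ.* P) ⟩
        N ℕ.* Y ℕ.+ (m ℕ.* Y ℕ.+ m ℕ.* P) ∎
        where
        open ≡-Reasoning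
        pointwise : ∀ A → A ∈ U → q ℕ.* length (isotropicVectors A) ℕ.+ m ℕ.* P ≡ Y ℕ.+ (m ℕ.* Y ℕ.+ m ℕ.* P) ℕ.* δ A
        pointwise A A∈ with Vecₚ.≡-dec _≟ᵛ_ zeroMat A
        ... | yes refl = begin
          q ℕ.* length (isotropicVectors A) ℕ.+ m ℕ.* P ≡⟨ cong (ℕ._+ m ℕ.* P) isotropic-zero ⟩
          Y ℕ.+ m ℕ.* Y ℕ.+ m ℕ.* P                     ≡⟨ ℕₚ.+-assoc Y _ _ ⟩
          Y ℕ.+ (m ℕ.* Y ℕ.+ m ℕ.* P)                   ≡⟨ cong (Y ℕ.+_) (ℕₚ.*-identityʳ _) ⟨
          Y ℕ.+ (m ℕ.* Y ℕ.+ m ℕ.* P) ℕ.* 1             ∎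
        ... | no 0≢A = trans (proj₂ (isotropic-rank A∈ (0≢A ∘ sym)) odd)
                         (sym (trans (cong (Y ℕ.+_) (ℕₚ.*-zeroʳ (m ℕ.* Y ℕ.+ m ℕ.* P))) (ℕₚ.+-identityʳ Y)))

      mY≡ : m ℕ.* Y ≡ q ℕ.^ k ℕ.* (m ℕ.* P)
      mY≡ = begin
        m ℕ.* Y                     ≡⟨ cong (m ℕ.*_) Y≡q^k*P ⟩
        m ℕ.* (q ℕ.^ k ℕ.* P)       ≡⟨ ℕₚ.*-assoc m _ P ⟨
        m ℕ.* q ℕ.^ k ℕ.* P         ≡⟨ cong (ℕ._* P) (ℕₚ.*-comm m _) ⟩
        q ℕ.^ k ℕ.* m ℕ.* P         ≡⟨ ℕₚ.*-assoc (q ℕ.^ k) m P ⟩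
        q ℕ.^ k ℕ.* (m ℕ.* P)       ∎
        where open ≡-Reasoning

      -- Comparison with `total->` leaves N m P < (q^k + 1) m P. Without strictness the bound would
      -- be q^k + 1.
      odd-bound : k % 2 ≡ 1 → N ≤ q ℕ.^ k
      odd-bound odd = ℕₚ.≤-pred (ℕₚ.*-cancelʳ-< (m ℕ.* P) N (suc (q ℕ.^ k)) (ℕₚ.+-cancelˡ-< (N ℕ.* Y) _ _ (begin-strict
        N ℕ.* Y ℕ.+ N ℕ.* (m ℕ.* P)              <⟨ ℕₚ.+-monoˡ-< (N ℕ.* (m ℕ.* P)) total-> ⟩
        isotropicTotal ℕ.+ N ℕ.* (m ℕ.* P)       ≡⟨ odd-total odd ⟩
        N ℕ.* Y ℕ.+ (m ℕ.* Y ℕ.+ m ℕ.* P)        ≡⟨ cong (N ℕ.* Y ℕ.+_) (trans (ℕₚ.+-comm (m ℕ.* Y) _) (cong (m ℕ.* P ℕ.+_) mY≡)) ⟩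
        N ℕ.* Y ℕ.+ suc (q ℕ.^ k) ℕ.* (m ℕ.* P)  ∎)))
        where open ℕₚ.≤-Reasoning

      -- Since N divides a power of q, it is coprime to q^k - 1 and to q - 1, and both factors can
      -- be cancelled in turn.
      even-bound : k % 2 ≡ 0 → N ≤ P
      even-bound even = Div.∣⇒≤ (coprime-divisor coprime-m (coprime-divisor coprime-q^k-1 N∣))
        where
        open ≡-Reasoning
        total : isotropicTotal ≡ N ℕ.* (Y ℕ.+ m ℕ.* P) ℕ.+ pred (q ℕ.^ k) ℕ.* (m ℕ.* P)
        total = ℕₚ.+-cancelʳ-≡ (m ℕ.* P) _ _ (begin
          isotropicTotal ℕ.+ m ℕ.* P                          ≡⟨ even-total even ⟩
          N ℕ.* (Y ℕ.+ m ℕ.* P) ℕ.+ m ℕ.* Y                   ≡⟨ cong (N ℕ.* (Y ℕ.+ m ℕ.* P) ℕ.+_) mY≡ ⟩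
          N ℕ.* (Y ℕ.+ m ℕ.* P) ℕ.+ q ℕ.^ k ℕ.* (m ℕ.* P)
            ≡⟨ cong (λ x → N ℕ.* (Y ℕ.+ m ℕ.* P) ℕ.+ x ℕ.* (m ℕ.* P)) (ℕₚ.suc-pred (q ℕ.^ k)) ⟨
          N ℕ.* (Y ℕ.+ m ℕ.* P) ℕ.+ (m ℕ.* P ℕ.+ pred (q ℕ.^ k) ℕ.* (m ℕ.* P))
            ≡⟨ cong (N ℕ.* (Y ℕ.+ m ℕ.* P) ℕ.+_) (ℕₚ.+-comm (m ℕ.* P) _) ⟩
          N ℕ.* (Y ℕ.+ m ℕ.* P) ℕ.+ (pred (q ℕ.^ k) ℕ.* (m ℕ.* P) ℕ.+ m ℕ.* P)
            ≡⟨ ℕₚ.+-assoc (N ℕ.* (Y ℕ.+ m ℕ.* P)) _ _ ⟨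
          N ℕ.* (Y ℕ.+ m ℕ.* P) ℕ.+ pred (q ℕ.^ k) ℕ.* (m ℕ.* P) ℕ.+ m ℕ.* P ∎)
        N∣ : N ∣ pred (q ℕ.^ k) ℕ.* (m ℕ.* P)
        N∣ = Div.∣m+n∣m⇒∣n (subst (N ∣_) total order-∣-total) (Div.∣m⇒∣m*n (Y ℕ.+ m ℕ.* P) Div.∣-refl)
        coprime-N : ∀ {x} → Coprime q x → Coprime N x
        coprime-N q⊥x (d∣N , d∣x) = let e , N∣q^e = subgroup-order U≤ in coprime-power q⊥x e (∣-trans d∣N N∣q^e , d∣x)
        coprime-q^k-1 : Coprime N (pred (q ℕ.^ k))
        coprime-q^k-1 = coprime-N (coprime-pred-power q 1≤k)
        coprime-m : Coprime N m
        -- The case of exponent 1, where `q ^ 1` unfolds to `q * 1`.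
        coprime-m = coprime-N (subst (λ x → Coprime q (pred x)) (ℕₚ.*-identityʳ q) (coprime-pred-power q ℕₚ.≤-refl))

open import Data.Nat using (_*_; _∸_; _^_)

theorem3p4 : (q : ℕ) → IsPrimePower q → (F : FiniteField (q * q)) →
    (n k : ℕ) → 1 ≤ n → 1 ≤ k → k ≤ n →
    (U : List (Hermitian.Mat q F n)) → Unique U →
    (∀ {A} → A ∈ U → Hermitian.IsHermitian q F A) →
    Hermitian.IsLinear q F U → Hermitian.ConstantRankDistance q F k U →
    (k % 2 ≡ 1 → length U ≤ q ^ k) × (k % 2 ≡ 0 → length U ≤ q ^ (2 * n ∸ k))
-- An empty list is closed under combinations but contains no zero matrix, so it is not a subgroup
-- and is treated apart.
theorem3p4 q q-primePower F n k _ 1≤k k≤n [] _ _ _ _ = (λ _ → z≤n) , (λ _ → z≤n)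
theorem3p4 q q-primePower F n k _ 1≤k k≤n U@(_ ∷ _) U! herm linear (_ , rank) =
  odd-bound subgroup herm 1≤k k≤n rank , even-bound subgroup herm 1≤k k≤n rank
  where
  open LinearConstantRank q-primePower F
  subgroup : MatrixSubgroups.IsSubgroup n U
  subgroup = linear-subgroup (here refl) U! linear
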